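{- Let $(A_n,B_n)_{n\ge2}$, $A_n=(a_n(m,k))_{1\le m,k\le n}$, $B_n=(b_n(m,k))_{1\le m,k\le n}$, be the twin Seidel matrix sequence. Then for every $n\ge2$ and all $1\le m,k\le n$: $$a_n(m,k)=\#\{w\in \mathrm{And}_n^{I}:\ (\mathbf{F}\,w,\mathbf{NL}\,w)=(m,k)\},\qquad b_n(m,k)=\#\{w\in \mathrm{And}_n^{II}:\ (\mathbf{L}\,w,\mathbf{grn}\,w)=(m,k)\}.$$
   Context: Andr\'e permutations: words $w=x_1\cdots x_n$ are permutations of a finite set $Y$ of positive integers; the empty word and every one-letter word are Andr\'e I and Andr\'e II. For $|Y|\ge2$ write $w=v\,\min(w)\,v'$; $w$ is Andr\'e I (resp. II) if $v,v'$ are Andr\'e I (resp. II) and $\max(vv')$ (resp. $\min(vv')$) is a letter of $v'$. $\mathrm{And}_n^{I}$, $\mathrm{And}_n^{II}$: Andr\'e I, II permutations of $\{1,\dots,n\}$. $\mathbf{F}\,w=x_1$, $\mathbf{L}\,w=x_n$, $\mathbf{NL}\,w=x_{n-1}$, $\mathbf{grn}\,w=\max\{x_{i-1},x_{i+1}\}$ where $x_i=n$, with $x_0=x_{n+1}=0$. Twin Seidel matrix sequence: the unique sequence of square matrices $A_n=(a_n(m,k))$, $B_n=(b_n(m,k))$ of dimension $n$ ($n\ge2$) with nonnegative integer entries satisfying, with $a_n(m,\bullet)=\sum_k a_n(m,k)$, $a_n(\bullet,k)=\sum_m a_n(m,k)$ and similarly for $b$: (TS1) all diagonal entries of all $A_n,B_n$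 are $0$, except $a_2(1,1)=1$; (TS2) for $n\ge3$: $a_n(m,n)=b_n(m,n)=0$ for all $m$, $a_n(n,k)=b_n(1,k)=0$ for all $k$, and $b_n(n,1)=0$; (TS3) $A_2=\begin{pmatrix}1&0\\0&0\end{pmatrix}$, $B_2=\begin{pmatrix}0&0\\1&0\end{pmatrix}$; (TS4) for $n\ge3$: $b_n(n,k)=a_{n-1}(\bullet,k-1)$ for $2\le k\le n-1$; $b_n(n-1,k)=a_{n-1}(\bullet,k)$ for $1\le k\le n-2$; $b_n(m+1,k)-b_n(m,k)=a_{n-1}(m,k)$ for $2\le k+1\le m\le n-2$; $b_n(m+1,k)-b_n(m,k)=a_{n-1}(m,k-1)$ for $3\le m+2\le k\le n-1$; (TS5) for $n\ge3$: $a_n(1,k)=b_{n-1}(\bullet,k-1)$ for $2\le k\le n-1$; $a_n(m+1,k)-a_n(m,k)=-b_{n-1}(m,k-1)$ for $3\le m+2\le k\le n-1$; $a_n(m+1,k)-a_n(m,k)=-b_{n-1}(m,k)$ for $2\le k+1\le m\le n-1$. -}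

module Defs where

open import Data.Nat using (ℕ; zero; suc; _+_; _∸_; _≤_; _<_; _⊔_; _≡ᵇ_)
open import Data.Bool using (if_then_else_)
open import Data.List using (List; []; _∷_; [_]; _++_; map; upTo; length)
open import Data.Nat.ListAction using (sum)
open import Data.List.Relation.Unary.All using (All)
open import Data.List.Membership.Propositional using (_∈_)
open import Data.List.Relation.Unary.Unique.Propositional using (Unique)
open import Data.List.Relation.Binary.Permutation.Propositional using (_↭_)
open import Data.Product using (Σ; ∃; _×_; _,_)
open import Function.Bundles using (_⇔_)
open import Relation.Binary.PropositionalEquality using (_≡_; _≢_)
open import Relation.Nullary using (¬_)

oneTo : ℕ → List ℕ
oneTo n = map suc (upTo n)

IsPerm : ℕ → List ℕ → Set
IsPerm n w = w ↭ oneTo n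

data AndreI : List ℕ → Set where
  andreI-nil    : AndreI []
  andreI-single : ∀ x → AndreI [ x ]
  andreI-split  : ∀ {v v' : List ℕ} {x : ℕ} →
                  AndreI v → AndreI v' →
                  All (x <_) (v ++ v') →
                  (∃ λ y → y ∈ v' × All (_≤ y) (v ++ v')) →
                  AndreI (v ++ x ∷ v')

data AndreII : List ℕ → Set where
  andreII-nil    : AndreII []
  andreII-single : ∀ x → AndreII [ x ]
  andreII-split  : ∀ {v v' : List ℕ} {x : ℕ} →
                   AndreII v → AndreII v' →
                   All (x <_) (v ++ v') →
                   (∃ λ y → y ∈ v' × All (y ≤_) (v ++ v')) →
                   AndreII (v ++ x ∷ v')

AndI : ℕ → List ℕ → Set
AndI n w = IsPerm n w × AndreI w

AndII : ℕ → List ℕ → Set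
AndII n w = IsPerm n w × AndreII w

F : List ℕ → ℕ
F []      = 0
F (x ∷ _) = x

L : List ℕ → ℕ
L []           = 0
L (x ∷ [])     = x
L (_ ∷ y ∷ ys) = L (y ∷ ys)

NL : List ℕ → ℕ
NL []               = 0
NL (_ ∷ [])         = 0
NL (x ∷ y ∷ [])     = x
NL (_ ∷ y ∷ z ∷ zs) = NL (y ∷ z ∷ zs)

headOr0 : List ℕ → ℕ
headOr0 []      = 0
headOr0 (x ∷ _) = x

-- grn' n p w : p is the letter preceding w (0 at the start)
grn' : ℕ → ℕ → List ℕ → ℕ
grn' n p []       = 0
grn' n p (x ∷ xs) = if x ≡ᵇ n then p ⊔ headOr0 xs else grn' n x xs

-- grn w = max of the neighbours of the letter n = |w| (with x_0 = x_{n+1} = 0)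
grn : List ℕ → ℕ
grn w = grn' (length w) 0 w

HasCount : (List ℕ → Set) → ℕ → Set
HasCount P c = Σ (List (List ℕ)) λ ws →
  Unique ws × (∀ w → (w ∈ ws) ⇔ P w) × length ws ≡ c

-- matrices: M n m k is the (m,k) entry (1-based) of the n×n matrix M_n
Mat : Set
Mat = ℕ → ℕ → ℕ → ℕ

rowSum : Mat → ℕ → ℕ → ℕ
rowSum M n m = sum (map (λ k → M n m k) (oneTo n))

colSum : Mat → ℕ → ℕ → ℕ
colSum M n k = sum (map (λ m → M n m k) (oneTo n))

record TwinSeidel (A B : Mat) : Set where
  field
    ts1a : ∀ {n m} → 2 ≤ n → 1 ≤ m → m ≤ n → ¬ (n ≡ 2 × m ≡ 1) → A n m m ≡ 0
    ts1b : ∀ {n m} → 2 ≤ n → 1 ≤ m → m ≤ n → B n m m ≡ 0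
    ts2a : ∀ {n m} → 3 ≤ n → 1 ≤ m → m ≤ n → A n m n ≡ 0
    ts2b : ∀ {n m} → 3 ≤ n → 1 ≤ m → m ≤ n → B n m n ≡ 0
    ts2c : ∀ {n k} → 3 ≤ n → 1 ≤ k → k ≤ n → A n n k ≡ 0
    ts2d : ∀ {n k} → 3 ≤ n → 1 ≤ k → k ≤ n → B n 1 k ≡ 0
    ts2e : ∀ {n} → 3 ≤ n → B n n 1 ≡ 0
    ts3a11 : A 2 1 1 ≡ 1
    ts3a12 : A 2 1 2 ≡ 0
    ts3a21 : A 2 2 1 ≡ 0
    ts3a22 : A 2 2 2 ≡ 0
    ts3b11 : B 2 1 1 ≡ 0
    ts3b12 : B 2 1 2 ≡ 0
    ts3b21 : B 2 2 1 ≡ 1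
    ts3b22 : B 2 2 2 ≡ 0
    ts4a : ∀ {n k} → 3 ≤ n → 2 ≤ k → k ≤ n ∸ 1 →
           B n n k ≡ colSum A (n ∸ 1) (k ∸ 1)
    ts4b : ∀ {n k} → 3 ≤ n → 1 ≤ k → k ≤ n ∸ 2 →
           B n (n ∸ 1) k ≡ colSum A (n ∸ 1) k
    ts4c : ∀ {n m k} → 3 ≤ n → 2 ≤ k + 1 → k + 1 ≤ m → m ≤ n ∸ 2 →
           B n (m + 1) k ≡ B n m k + A (n ∸ 1) m k
    ts4d : ∀ {n m k} → 3 ≤ n → 3 ≤ m + 2 → m + 2 ≤ k → k ≤ n ∸ 1 →
           B n (m + 1) k ≡ B n m k + A (n ∸ 1) m (k ∸ 1)
    -- (TS5)  (a(m+1,k) - a(m,k) = - b(...)  written additively)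
    ts5a : ∀ {n k} → 3 ≤ n → 2 ≤ k → k ≤ n ∸ 1 →
           A n 1 k ≡ colSum B (n ∸ 1) (k ∸ 1)
    ts5b : ∀ {n m k} → 3 ≤ n → 3 ≤ m + 2 → m + 2 ≤ k → k ≤ n ∸ 1 →
           A n (m + 1) k + B (n ∸ 1) m (k ∸ 1) ≡ A n m k
    ts5c : ∀ {n m k} → 3 ≤ n → 2 ≤ k + 1 → k + 1 ≤ m → m ≤ n ∸ 1 →
           A n (m + 1) k + B (n ∸ 1) m k ≡ A n m k

{-# OPTIONS --safe #-}
-- Call the product (φ ⋆ ψ)(w) = Σ φ(u) ψ(v), over all ways to split the word w into complementary
-- subsequences u and v, the shuffle product; the derivations φ ↦ φ(x ∷ _) obey the Leibniz rule. Cutting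
-- an André word at its least letter turns the generating series of the statistics into products. For type I
-- this gives a = f ⋆ p, where f records the first letter of the left part and p the letter before the
-- greatest one in the right part. For type II cutting gives only a recursion, whose solution is b = e ⋆ p
-- with e recording the last letter and the same p. By the Leibniz rule the recurrences of the matrices,
-- which compare the words with marked letters m and m + 1, reduce to those relating e and f alone (the
-- Entringer recurrences), and these follow by induction from the same two product formulas. The
-- recurrences and boundary values determine the matrices uniquely.
module Submission where

open import Defs
open import Algebra.Properties.CommutativeSemigroup using (interchange; xy∙z≈xz∙y)
open import Data.Bool using (Bool; true; false; if_then_else_; _∧_; T)
open import Data.Empty using (⊥-elim)
open import Data.List
  using (List; []; _∷_; _∷ʳ_; _++_; map; length; [_]; upTo; applyUpTo; cartesianProduct; initLast; _∷ʳ′_)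
open import Data.List.Membership.Propositional using (_∈_; _∉_)
open import Data.List.Membership.Propositional.Properties
  using (∈-++⁺ˡ; ∈-++⁺ʳ; ∈-++⁻; ∈-map⁺; ∈-map⁻; ∈-cartesianProduct⁺; ∈-cartesianProduct⁻; ∈-∃++; ∈-upTo⁻)
open import Data.List.Membership.Propositional.Properties.WithK using (unique∧set⇒bag)
open import Data.List.Properties
  using (length-++; length-map; length-upTo; map-++; ++-assoc; map-applyUpTo; applyUpTo-∷ʳ;
         ∷-injective; ∷-injectiveʳ; ∷ʳ-injectiveˡ)
open import Data.List.Relation.Binary.BagAndSetEquality using (∼bag⇒↭)
open import Data.List.Relation.Binary.Permutation.Propositional using (_↭_; ↭-refl; ↭-sym; ↭-trans; prep)
open import Data.List.Relation.Binary.Permutation.Propositional.Properties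
  using (↭-empty-inv; ↭-singleton-inv; ∈-resp-↭; All-resp-↭; ↭-length; ++⁺; shift; drop-mid; drop-∷)
open import Data.List.Relation.Ternary.Interleaving using ([])
open import Data.List.Relation.Ternary.Interleaving.Propositional using (Interleaving; consˡ; consʳ; toPermutation)
open import Data.List.Relation.Unary.All as All using (All; []; _∷_)
import Data.List.Relation.Unary.All.Properties as Allₚ
open import Data.List.Relation.Unary.AllPairs as AllPairs using (AllPairs; []; _∷_)
import Data.List.Relation.Unary.AllPairs.Properties as AllPairsₚ
open import Data.List.Relation.Unary.Any using (here; there)
open import Data.List.Relation.Unary.Unique.Propositional using (Unique)
import Data.List.Relation.Unary.Unique.Propositional.Properties as Uniqueₚ
open import Data.Nat using (ℕ; zero; suc; _+_; _*_; _≤_; _<_; z≤n; s≤s; s≤s⁻¹; _≡ᵇ_; _⊔_)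
open import Data.Nat.ListAction using (sum)
open import Data.Nat.Properties
open import Data.Product using (Σ; ∃; ∃₂; _×_; _,_; proj₁; proj₂)
open import Data.Sum using (_⊎_; inj₁; inj₂; [_,_]′)
open import Data.Unit using (⊤; tt)
open import Function using (_∘_; case_of_; const; id; _⇔_; mk⇔; Equivalence)
open import Relation.Binary using (tri<; tri≈; tri>)
open import Relation.Binary.PropositionalEquality hiding ([_])
open import Relation.Nullary using (¬_; yes; no)
open import Relation.Nullary.Decidable using (dec-false; dec-true)

open ≡-Reasoning

-- The product `𝓕 ⋆ 𝓟` separates the two statistics. Moving the row mark from a letter to the next
-- one is invisible to the right factor, and the left factor vanishes unless it receives the marked
-- letter. Unless one of the two is the least letter, only splits with both on the left are
-- affected, and there the question is the same one for a shorter word and a single statistic. This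
-- is why everything is phrased with marks: a series reads the marks of the letters in increasing
-- order, never the letters. Deleting a letter is deleting a list entry, and the shift from k to k -
-- 1 in half of the recurrences is the renumbering above the deleted letter. `NL` for type I, and
-- `grn` and `L` for type II, all lead to one recursion, that of `𝓟`; in particular the two matrices
-- have the same column sums.

private variable A B I X Y : Set

-- Sums and interleavings

+-interchange : ∀ a b c d → (a + b) + (c + d) ≡ (a + c) + (b + d)
+-interchange = interchange +-commutativeSemigroup

Interleaving-All : {P : X → Set} {u v w : List X} → Interleaving u v w → All P w → All P u × All P v
Interleaving-All [] [] = [] , []
Interleaving-All (consˡ i) (p ∷ ps) = let pu , pv = Interleaving-All i ps in p ∷ pu , pv
Interleaving-All (consʳ i) (p ∷ ps) = let pu , pv = Interleaving-All i ps in pu , p ∷ pv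

Interleaving-length : {u v w : List X} → Interleaving u v w → length u ≤ length w × length v ≤ length w
Interleaving-length [] = z≤n , z≤n
Interleaving-length (consˡ i) = let p , q = Interleaving-length i in s≤s p , m≤n⇒m≤1+n q
Interleaving-length (consʳ i) = let p , q = Interleaving-length i in m≤n⇒m≤1+n p , s≤s q

length-∷ʳ : (w : List X) (t : X) → length (w ∷ʳ t) ≡ suc (length w)
length-∷ʳ w t = trans (length-++ w) (+-comm (length w) 1)

-- Series under the shuffle product

Series : Set → Set
Series X = List X → ℕ

∂ : X → Series X → Series X
∂ x φ w = φ (x ∷ w)

infixl 7 _⋆_

-- With the Leibniz rule as definition, differentiating a product is a computation; the reading as a
-- sum over splits is recovered through `Interleaving` in `⋆-cong` and `hc-⋆`.
_⋆_ : Series X → Series X → Series X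
(φ ⋆ ψ) []      = φ [] * ψ []
(φ ⋆ ψ) (x ∷ w) = (∂ x φ ⋆ ψ) w + (φ ⋆ ∂ x ψ) w

⋆-cong : {φ φ′ ψ ψ′ : Series X} (w : List X) →
  (∀ {u v} → Interleaving u v w → φ u * ψ v ≡ φ′ u * ψ′ v) → (φ ⋆ ψ) w ≡ (φ′ ⋆ ψ′) w
⋆-cong [] h = h []
⋆-cong (x ∷ w) h = cong₂ _+_ (⋆-cong w (λ i → h (consˡ i))) (⋆-cong w (λ i → h (consʳ i)))

⋆-zero : {φ ψ : Series X} (w : List X) →
  (∀ {u v} → Interleaving u v w → φ u * ψ v ≡ 0) → (φ ⋆ ψ) w ≡ 0
⋆-zero [] h = h []
⋆-zero (x ∷ w) h = cong₂ _+_ (⋆-zero w (λ i → h (consˡ i))) (⋆-zero w (λ i → h (consʳ i)))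

⋆-zeroˡ : {φ ψ : Series X} (w : List X) → (∀ {u v} → Interleaving u v w → φ u ≡ 0) → (φ ⋆ ψ) w ≡ 0
⋆-zeroˡ {ψ = ψ} w h = ⋆-zero w (λ {u} {v} i → cong (_* ψ v) (h i))

⋆-ext : {φ φ′ ψ ψ′ : Series X} → (∀ u → φ u ≡ φ′ u) → (∀ v → ψ v ≡ ψ′ v) →
  ∀ w → (φ ⋆ ψ) w ≡ (φ′ ⋆ ψ′) w
⋆-ext p q w = ⋆-cong w (λ {u} {v} _ → cong₂ _*_ (p u) (q v))

⋆-comm : (φ ψ : Series X) (w : List X) → (φ ⋆ ψ) w ≡ (ψ ⋆ φ) w
⋆-comm φ ψ [] = *-comm (φ []) (ψ [])
⋆-comm φ ψ (x ∷ w) = trans (cong₂ _+_ (⋆-comm (∂ x φ) ψ w) (⋆-comm φ (∂ x ψ) w))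
                           (+-comm _ ((∂ x ψ ⋆ φ) w))

⋆-distribʳ : (φ φ′ ψ : Series X) (w : List X) → ((λ u → φ u + φ′ u) ⋆ ψ) w ≡ (φ ⋆ ψ) w + (φ′ ⋆ ψ) w
⋆-distribʳ φ φ′ ψ [] = *-distribʳ-+ (ψ []) (φ []) (φ′ [])
⋆-distribʳ φ φ′ ψ (x ∷ w) = trans
  (cong₂ _+_ (⋆-distribʳ (∂ x φ) (∂ x φ′) ψ w) (⋆-distribʳ φ φ′ (∂ x ψ) w))
  (+-interchange ((∂ x φ ⋆ ψ) w) _ _ _)

⋆-distribˡ : (φ ψ ψ′ : Series X) (w : List X) → (φ ⋆ (λ u → ψ u + ψ′ u)) w ≡ (φ ⋆ ψ) w + (φ ⋆ ψ′) w
⋆-distribˡ φ ψ ψ′ w = trans (⋆-comm φ _ w) (trans (⋆-distribʳ ψ ψ′ φ w)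
  (cong₂ _+_ (⋆-comm ψ φ w) (⋆-comm ψ′ φ w)))

⋆-assoc : (φ ψ χ : Series X) (w : List X) → ((φ ⋆ ψ) ⋆ χ) w ≡ (φ ⋆ (ψ ⋆ χ)) w
⋆-assoc φ ψ χ [] = *-assoc (φ []) (ψ []) (χ [])
⋆-assoc φ ψ χ (x ∷ w) = begin
  ((λ u → (∂ x φ ⋆ ψ) u + (φ ⋆ ∂ x ψ) u) ⋆ χ) w + ((φ ⋆ ψ) ⋆ ∂ x χ) w
    ≡⟨ cong₂ _+_ (⋆-distribʳ (∂ x φ ⋆ ψ) (φ ⋆ ∂ x ψ) χ w) (⋆-assoc φ ψ (∂ x χ) w) ⟩
  (((∂ x φ ⋆ ψ) ⋆ χ) w + ((φ ⋆ ∂ x ψ) ⋆ χ) w) + (φ ⋆ (ψ ⋆ ∂ x χ)) w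
    ≡⟨ cong (_+ (φ ⋆ (ψ ⋆ ∂ x χ)) w) (cong₂ _+_ (⋆-assoc (∂ x φ) ψ χ w) (⋆-assoc φ (∂ x ψ) χ w)) ⟩
  ((∂ x φ ⋆ (ψ ⋆ χ)) w + (φ ⋆ (∂ x ψ ⋆ χ)) w) + (φ ⋆ (ψ ⋆ ∂ x χ)) w
    ≡⟨ +-assoc ((∂ x φ ⋆ (ψ ⋆ χ)) w) _ _ ⟩
  (∂ x φ ⋆ (ψ ⋆ χ)) w + ((φ ⋆ (∂ x ψ ⋆ χ)) w + (φ ⋆ (ψ ⋆ ∂ x χ)) w)
    ≡⟨ cong ((∂ x φ ⋆ (ψ ⋆ χ)) w +_) (⋆-distribˡ φ (∂ x ψ ⋆ χ) (ψ ⋆ ∂ x χ) w) ⟨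
  (∂ x φ ⋆ (ψ ⋆ χ)) w + (φ ⋆ (λ u → (∂ x ψ ⋆ χ) u + (ψ ⋆ ∂ x χ) u)) w ∎

⋆-left-comm : (φ ψ χ : Series X) (w : List X) → (φ ⋆ (ψ ⋆ χ)) w ≡ (ψ ⋆ (φ ⋆ χ)) w
⋆-left-comm φ ψ χ w = trans (sym (⋆-assoc φ ψ χ w))
  (trans (⋆-ext (⋆-comm φ ψ) (λ _ → refl) w) (⋆-assoc ψ φ χ w))

δ : Series X
δ []      = 1
δ (_ ∷ _) = 0

⋆-identityˡ : (ψ : Series X) (w : List X) → (δ ⋆ ψ) w ≡ ψ w
⋆-identityˡ ψ [] = *-identityˡ (ψ [])
⋆-identityˡ ψ (x ∷ w) = cong₂ _+_ (⋆-zeroˡ {φ = ∂ x δ} w (λ _ → refl)) (⋆-identityˡ (∂ x ψ) w)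

⋆-snoc : (φ ψ : Series X) (w : List X) (t : X) →
  (φ ⋆ ψ) (w ∷ʳ t) ≡ ((λ u → φ (u ∷ʳ t)) ⋆ ψ) w + (φ ⋆ (λ v → ψ (v ∷ʳ t))) w
⋆-snoc φ ψ [] t = refl
⋆-snoc φ ψ (x ∷ w) t = trans (cong₂ _+_ (⋆-snoc (∂ x φ) ψ w t) (⋆-snoc φ (∂ x ψ) w t))
  (+-interchange (((λ u → φ (x ∷ (u ∷ʳ t))) ⋆ ψ) w) _ _ _)

⋆-map : (h : X → Y) (φ ψ : Series Y) (w : List X) → (φ ⋆ ψ) (map h w) ≡ ((φ ∘ map h) ⋆ (ψ ∘ map h)) w
⋆-map h φ ψ [] = refl
⋆-map h φ ψ (x ∷ w) = cong₂ _+_ (⋆-map h (∂ (h x) φ) ψ w) (⋆-map h φ (∂ (h x) ψ) w)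

-- Series defined by recursion on the length of the word

module _ (Φ : (I → Series X) → I → Series X) where

  -- A recursive call inside `⋆` is not structural, so recursion runs on fuel. If `Φ` consults its
  -- argument on shorter words only, any fuel above the length gives the same value.
  iter : ℕ → I → Series X
  iter zero    i w = 0
  iter (suc g) i w = Φ (iter g) i w

  fix : I → Series X
  fix i w = iter (suc (length w)) i w

  Contractive : Set
  Contractive = ∀ {φ φ′} i w → (∀ j v → length v < length w → φ j v ≡ φ′ j v) → Φ φ i w ≡ Φ φ′ i w

  module _ (contractive : Contractive) where

    iter-agree : ∀ g g′ i w → length w < g → length w < g′ → iter g i w ≡ iter g′ i w
    iter-agree (suc g) (suc g′) i w (s≤s p) (s≤s p′) = contractive i w
      (λ j v q → iter-agree g g′ j v (<-≤-trans q p) (<-≤-trans q p′))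

    fix-unfold : ∀ i w → fix i w ≡ Φ fix i w
    fix-unfold i w = contractive i w
      (λ j v q → iter-agree (length w) (suc (length v)) j v q ≤-refl)

onCons : ℕ → (X → Series X) → Series X
onCons c φ []      = c
onCons c φ (x ∷ w) = φ x w

onSnoc : ℕ → (List X → X → ℕ) → Series X
onSnoc c φ []      = c
onSnoc c φ (x ∷ w) = onSnoc (φ [] x) (λ u → φ (x ∷ u)) w

onSnoc-∷ʳ : (c : ℕ) (φ : List X → X → ℕ) (w : List X) (t : X) → onSnoc c φ (w ∷ʳ t) ≡ φ w t
onSnoc-∷ʳ c φ []      t = refl
onSnoc-∷ʳ c φ (x ∷ w) t = onSnoc-∷ʳ (φ [] x) (λ u → φ (x ∷ u)) w t

onSnoc-cong : {φ ψ : List X → X → ℕ} (c : ℕ) (w : List X) →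
  (∀ u t → length u < length w → φ u t ≡ ψ u t) → onSnoc c φ w ≡ onSnoc c ψ w
onSnoc-cong c [] h = refl
onSnoc-cong {φ = φ} {ψ} c (x ∷ w) h = trans
  (cong (λ d → onSnoc d (λ u → φ (x ∷ u)) w) (h [] x (s≤s z≤n)))
  (onSnoc-cong (ψ [] x) w (λ u t p → h (x ∷ u) t (s≤s p)))

⋆-cong-≤ : {φ φ′ ψ ψ′ : Series X} (w : List X) →
  (∀ u → length u ≤ length w → φ u ≡ φ′ u) → (∀ v → length v ≤ length w → ψ v ≡ ψ′ v) →
  (φ ⋆ ψ) w ≡ (φ′ ⋆ ψ′) w
⋆-cong-≤ w p q = ⋆-cong w (λ {u} {v} i →
  cong₂ _*_ (p u (proj₁ (Interleaving-length i))) (q v (proj₂ (Interleaving-length i))))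

onCons-cong : {φ ψ : X → Series X} (c : ℕ) (w : List X) →
  (∀ x u → length u < length w → φ x u ≡ ψ x u) → onCons c φ w ≡ onCons c ψ w
onCons-cong c []      h = refl
onCons-cong c (x ∷ w) h = h x w ≤-refl

-- The series of the statistics

⟦_⟧ : Bool → ℕ
⟦ b ⟧ = if b then 1 else 0

-- Two letters are taken off: the least one, and the one that is forced into the right part (the
-- greatest for type I, the second least for type II). The others are shared freely. For exponential
-- generating functions this reads E'' = E E' with E(0) = E'(0) = 1, which is solved by sec + tan:
-- the values are the Euler numbers.
Φ𝓔 : (⊤ → Series X) → ⊤ → Series X
Φ𝓔 φ _ = onCons 1 (λ _ → onCons 1 (λ _ → φ tt) ⋆ φ tt)

Φ𝓔-contractive : Contractive (Φ𝓔 {X})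
Φ𝓔-contractive i w h = onCons-cong 1 w λ x u p → ⋆-cong-≤ u
  (λ v q → onCons-cong 1 v (λ _ v′ r → h tt v′ (<-trans r (≤-<-trans q p))))
  (λ v q → h tt v (≤-<-trans q p))

-- 𝓔 w is the number of André words (of either type) on a set of length w letters, and 𝓔⁺ w the
-- same for one more letter.
𝓔⁺ : Series X
𝓔⁺ = fix Φ𝓔 tt

𝓔 : Series X
𝓔 = onCons 1 (λ _ → 𝓔⁺)

𝓔⁺-∷ : (x : X) (w : List X) → 𝓔⁺ (x ∷ w) ≡ (𝓔 ⋆ 𝓔⁺) w
𝓔⁺-∷ x w = fix-unfold Φ𝓔 Φ𝓔-contractive tt (x ∷ w)

module _ (K : X → Bool) where

  Φ𝓟 : (Bool → Series X) → Bool → Series X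
  Φ𝓟 φ b = onCons ⟦ b ⟧ (λ x → 𝓔 ⋆ φ (K x))

  Φ𝓟-contractive : Contractive Φ𝓟
  Φ𝓟-contractive b w h = onCons-cong ⟦ b ⟧ w λ x u p →
    ⋆-cong-≤ u (λ _ _ → refl) (λ v q → h (K x) v (≤-<-trans q p))

  -- André words on w and one larger letter N, counted when the larger neighbour of N is marked by K;
  -- in the word N alone that neighbour is an outer letter, with mark b.
  𝓟 : Bool → Series X
  𝓟 = fix Φ𝓟

  𝓟-∷ : ∀ b x w → 𝓟 b (x ∷ w) ≡ (𝓔 ⋆ 𝓟 (K x)) w
  𝓟-∷ b x w = fix-unfold Φ𝓟 Φ𝓟-contractive b (x ∷ w)

module _ (M : X → Bool) where

  -- André II words on w whose last letter is marked by M.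
  𝓛 : Bool → Series X
  𝓛 b = onCons ⟦ b ⟧ (λ x → 𝓟 M (M x))

  -- The word is completed by one smaller letter with mark `b`, at which it is cut. The greatest
  -- letter is forced to the right, which turns the right factor into `𝓔⁺`; hence the recursion
  -- peels the last letter. If the left part is empty, the smaller letter is first, so `b` is passed
  -- on as default.
  Φ𝓕 : (Bool → Series X) → Bool → Series X
  Φ𝓕 φ b = onSnoc ⟦ b ⟧ (λ w _ → (onCons ⟦ b ⟧ (λ x → φ (M x)) ⋆ 𝓔⁺) w)

  Φ𝓕-contractive : Contractive Φ𝓕
  Φ𝓕-contractive b w h = onSnoc-cong ⟦ b ⟧ w λ u t p → ⋆-cong-≤ u
    (λ v q → onCons-cong ⟦ b ⟧ v (λ x v′ r → h (M x) v′ (<-trans r (≤-<-trans q p))))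
    (λ _ _ → refl)

  𝓕⁺ : Bool → Series X
  𝓕⁺ = fix Φ𝓕

  -- André I words on w whose first letter is marked by M.
  𝓕 : Bool → Series X
  𝓕 b = onCons ⟦ b ⟧ (λ x → 𝓕⁺ (M x))

  𝓕⁺-∷ʳ : ∀ b w t → 𝓕⁺ b (w ∷ʳ t) ≡ (𝓕 b ⋆ 𝓔⁺) w
  𝓕⁺-∷ʳ b w t = trans (fix-unfold Φ𝓕 Φ𝓕-contractive b (w ∷ʳ t))
    (onSnoc-∷ʳ ⟦ b ⟧ (λ w _ → (𝓕 b ⋆ 𝓔⁺) w) w t)

-- Naturality in the alphabet

length-ind : (P : List X → Set) → (∀ w → (∀ v → length v < length w → P v) → P w) → ∀ w → P w
length-ind {X} P step w = go (suc (length w)) w ≤-refl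
  where
  go : ∀ n (w : List X) → length w < n → P w
  go (suc n) w (s≤s p) = step w (λ v q → go n v (<-≤-trans q p))

<-∷ʳ : (w : List X) {t : X} {v : List X} → length v ≤ length w → length v < length (w ∷ʳ t)
<-∷ʳ w {t} p = subst (_ <_) (sym (length-∷ʳ w t)) (s≤s p)

module _ (h : X → Y) where

  𝓔⁺-map : ∀ w → 𝓔⁺ (map h w) ≡ 𝓔⁺ w
  𝓔⁺-map = length-ind _ step
    where
    step : ∀ w → (∀ v → length v < length w → 𝓔⁺ (map h v) ≡ 𝓔⁺ v) → 𝓔⁺ (map h w) ≡ 𝓔⁺ w
    step [] ih = refl
    step (x ∷ w) ih = begin
      𝓔⁺ (h x ∷ map h w)                    ≡⟨ 𝓔⁺-∷ (h x) (map h w) ⟩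
      (𝓔 ⋆ 𝓔⁺) (map h w)                    ≡⟨ ⋆-map h 𝓔 𝓔⁺ w ⟩
      ((𝓔 ∘ map h) ⋆ (𝓔⁺ ∘ map h)) w         ≡⟨ ⋆-cong-≤ w 𝓔-map (λ v p → ih v (s≤s p)) ⟩
      (𝓔 ⋆ 𝓔⁺) w                            ≡⟨ 𝓔⁺-∷ x w ⟨
      𝓔⁺ (x ∷ w)                            ∎
      where
      𝓔-map : ∀ u → length u ≤ length w → 𝓔 (map h u) ≡ 𝓔 u
      𝓔-map [] _ = refl
      𝓔-map (y ∷ u) p = ih u (m≤n⇒m≤1+n p)

  𝓔-map : ∀ w → 𝓔 (map h w) ≡ 𝓔 w
  𝓔-map []      = refl
  𝓔-map (x ∷ w) = 𝓔⁺-map w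

  𝓟-map : (K : Y → Bool) → ∀ w b → 𝓟 K b (map h w) ≡ 𝓟 (K ∘ h) b w
  𝓟-map K = length-ind _ step
    where
    step : ∀ w → (∀ v → length v < length w → ∀ b → 𝓟 K b (map h v) ≡ 𝓟 (K ∘ h) b v) →
      ∀ b → 𝓟 K b (map h w) ≡ 𝓟 (K ∘ h) b w
    step [] ih b = refl
    step (x ∷ w) ih b = begin
      𝓟 K b (h x ∷ map h w)                          ≡⟨ 𝓟-∷ K b (h x) (map h w) ⟩
      (𝓔 ⋆ 𝓟 K (K (h x))) (map h w)                  ≡⟨ ⋆-map h 𝓔 _ w ⟩
      ((𝓔 ∘ map h) ⋆ (𝓟 K (K (h x)) ∘ map h)) w
        ≡⟨ ⋆-cong-≤ w (λ u _ → 𝓔-map u) (λ v p → ih v (s≤s p) (K (h x))) ⟩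
      (𝓔 ⋆ 𝓟 (K ∘ h) (K (h x))) w                    ≡⟨ 𝓟-∷ (K ∘ h) b x w ⟨
      𝓟 (K ∘ h) b (x ∷ w)                            ∎

  𝓛-map : (M : Y → Bool) → ∀ b w → 𝓛 M b (map h w) ≡ 𝓛 (M ∘ h) b w
  𝓛-map M b []      = refl
  𝓛-map M b (x ∷ w) = 𝓟-map M w (M (h x))

  𝓕⁺-map : (M : Y → Bool) → ∀ w b → 𝓕⁺ M b (map h w) ≡ 𝓕⁺ (M ∘ h) b w
  𝓕⁺-map M = length-ind _ step
    where
    step : ∀ w → (∀ v → length v < length w → ∀ b → 𝓕⁺ M b (map h v) ≡ 𝓕⁺ (M ∘ h) b v) →
      ∀ b → 𝓕⁺ M b (map h w) ≡ 𝓕⁺ (M ∘ h) b w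
    step w ih b with initLast w
    ... | [] = refl
    ... | w ∷ʳ′ t = begin
      𝓕⁺ M b (map h (w ∷ʳ t))              ≡⟨ cong (𝓕⁺ M b) (map-++ h w [ t ]) ⟩
      𝓕⁺ M b (map h w ∷ʳ h t)              ≡⟨ 𝓕⁺-∷ʳ M b (map h w) (h t) ⟩
      (𝓕 M b ⋆ 𝓔⁺) (map h w)               ≡⟨ ⋆-map h _ 𝓔⁺ w ⟩
      ((𝓕 M b ∘ map h) ⋆ (𝓔⁺ ∘ map h)) w    ≡⟨ ⋆-cong-≤ w 𝓕-map′ (λ v _ → 𝓔⁺-map v) ⟩
      (𝓕 (M ∘ h) b ⋆ 𝓔⁺) w                 ≡⟨ 𝓕⁺-∷ʳ (M ∘ h) b w t ⟨
      𝓕⁺ (M ∘ h) b (w ∷ʳ t)                ∎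
      where
      𝓕-map′ : ∀ u → length u ≤ length w → 𝓕 M b (map h u) ≡ 𝓕 (M ∘ h) b u
      𝓕-map′ [] _ = refl
      𝓕-map′ (x ∷ u) p = ih u (<-∷ʳ w {v = u} (<⇒≤ p)) (M (h x))

  𝓕-map : (M : Y → Bool) → ∀ b w → 𝓕 M b (map h w) ≡ 𝓕 (M ∘ h) b w
  𝓕-map M b []      = refl
  𝓕-map M b (x ∷ w) = 𝓕⁺-map M w (M (h x))

𝓔⁺-cong : (w w′ : List X) → length w ≡ length w′ → 𝓔⁺ w ≡ 𝓔⁺ w′
𝓔⁺-cong w w′ p = trans (sym (𝓔⁺-map (const tt) w))
  (trans (cong 𝓔⁺ (lemma w w′ p)) (𝓔⁺-map (const tt) w′))
  where
  lemma : (w w′ : List X) → length w ≡ length w′ → map (const tt) w ≡ map (const tt) w′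
  lemma [] [] _ = refl
  lemma (_ ∷ w) (_ ∷ w′) p = cong (tt ∷_) (lemma w w′ (suc-injective p))

𝓔-∷ʳ : (w : List X) (t : X) → 𝓔 (w ∷ʳ t) ≡ 𝓔⁺ w
𝓔-∷ʳ [] t = refl
𝓔-∷ʳ (x ∷ w) t = 𝓔⁺-cong (w ∷ʳ t) (x ∷ w) (length-∷ʳ w t)

𝓟-all : (w : List X) → 𝓟 (const true) true w ≡ 𝓔⁺ w
𝓟-all = length-ind _ step
  where
  step : ∀ w → (∀ v → length v < length w → 𝓟 (const true) true v ≡ 𝓔⁺ v) →
    𝓟 (const true) true w ≡ 𝓔⁺ w
  step [] ih = refl
  step (x ∷ w) ih = trans (𝓟-∷ (const true) true x w)
    (trans (⋆-cong-≤ w (λ _ _ → refl) (λ v p → ih v (s≤s p))) (sym (𝓔⁺-∷ x w)))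

𝓛-all : (w : List X) → 𝓛 (const true) true w ≡ 𝓔 w
𝓛-all []      = refl
𝓛-all (x ∷ w) = 𝓟-all w

𝓕⁺-all : (w : List X) → 𝓕⁺ (const true) true w ≡ 𝓔⁺ w
𝓕⁺-all = length-ind _ step
  where
  step : ∀ w → (∀ v → length v < length w → 𝓕⁺ (const true) true v ≡ 𝓔⁺ v) →
    𝓕⁺ (const true) true w ≡ 𝓔⁺ w
  step w ih with initLast w
  ... | [] = refl
  ... | w ∷ʳ′ t = begin
    𝓕⁺ (const true) true (w ∷ʳ t)        ≡⟨ 𝓕⁺-∷ʳ _ true w t ⟩
    (𝓕 (const true) true ⋆ 𝓔⁺) w         ≡⟨ ⋆-cong-≤ w 𝓕-all′ (λ _ _ → refl) ⟩
    (𝓔 ⋆ 𝓔⁺) w                           ≡⟨ 𝓔⁺-∷ t w ⟨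
    𝓔⁺ (t ∷ w)                           ≡⟨ 𝓔⁺-cong (t ∷ w) (w ∷ʳ t) (sym (length-∷ʳ w t)) ⟩
    𝓔⁺ (w ∷ʳ t)                          ∎
    where
    𝓕-all′ : ∀ u → length u ≤ length w → 𝓕 (const true) true u ≡ 𝓔 u
    𝓕-all′ [] _ = refl
    𝓕-all′ (x ∷ u) p = ih u (<-∷ʳ w {v = u} (<⇒≤ p))

𝓕-all : (w : List X) → 𝓕 (const true) true w ≡ 𝓔 w
𝓕-all []      = refl
𝓕-all (x ∷ w) = 𝓕⁺-all w

-- Words without marked letters

Free : (X → Bool) → List X → Set
Free M = All (λ x → M x ≡ false)

𝓟-free : (K : X → Bool) → ∀ w → Free K w → 𝓟 K false w ≡ 0
𝓟-free K = length-ind _ step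
  where
  step : ∀ w → (∀ v → length v < length w → Free K v → 𝓟 K false v ≡ 0) → Free K w → 𝓟 K false w ≡ 0
  step [] ih _ = refl
  step (x ∷ w) ih (Kx ∷ Kw) rewrite 𝓟-∷ K false x w | Kx =
    ⋆-zero w λ {u} {v} i → trans
      (cong (𝓔 u *_) (ih v (s≤s (proj₂ (Interleaving-length i))) (proj₂ (Interleaving-All i Kw))))
      (*-zeroʳ (𝓔 u))

𝓟-free-true : (K : X → Bool) → ∀ w → Free K w → 𝓟 K true w ≡ δ w
𝓟-free-true K [] _ = refl
𝓟-free-true K (x ∷ w) (Kx ∷ Kw) rewrite 𝓟-∷ K true x w | Kx =
  ⋆-zero w λ {u} {v} i → trans (cong (𝓔 u *_) (𝓟-free K v (proj₂ (Interleaving-All i Kw)))) (*-zeroʳ (𝓔 u))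

module _ (M : X → Bool) where

  𝓛-free : ∀ w → Free M w → 𝓛 M false w ≡ 0
  𝓛-free [] _ = refl
  𝓛-free (x ∷ w) (Mx ∷ Mw) rewrite Mx = 𝓟-free M w Mw

  𝓛-free-true : ∀ w → Free M w → 𝓛 M true w ≡ δ w
  𝓛-free-true [] _ = refl
  𝓛-free-true (x ∷ w) (Mx ∷ Mw) rewrite Mx = 𝓟-free M w Mw

  𝓕⁺-free : ∀ w → Free M w → 𝓕⁺ M false w ≡ 0
  𝓕⁺-free = length-ind _ step
    where
    step : ∀ w → (∀ v → length v < length w → Free M v → 𝓕⁺ M false v ≡ 0) → Free M w → 𝓕⁺ M false w ≡ 0
    step w ih Mw with initLast w
    ... | [] = refl
    ... | w ∷ʳ′ t rewrite 𝓕⁺-∷ʳ M false w t = ⋆-zeroˡ w λ i →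
      lemma _ (proj₁ (Interleaving-length i)) (proj₁ (Interleaving-All i (Allₚ.++⁻ˡ w Mw)))
      where
      lemma : ∀ u → length u ≤ length w → Free M u → 𝓕 M false u ≡ 0
      lemma [] _ _ = refl
      lemma (x ∷ u) p (Mx ∷ Mu) rewrite Mx = ih u (<-∷ʳ w {v = u} (<⇒≤ p)) Mu

  𝓕-free : ∀ w → Free M w → 𝓕 M false w ≡ 0
  𝓕-free [] _ = refl
  𝓕-free (x ∷ w) (Mx ∷ Mw) rewrite Mx = 𝓕⁺-free w Mw

  𝓕-free-true : ∀ w → Free M w → 𝓕 M true w ≡ δ w
  𝓕-free-true [] _ = refl
  𝓕-free-true (x ∷ w) (Mx ∷ Mw) rewrite Mx = 𝓕⁺-free w Mw

  ⋆-identity-free : {φ : Series X} (ψ : Series X) → (∀ u → Free M u → φ u ≡ δ u) →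
    ∀ w → Free M w → (φ ⋆ ψ) w ≡ ψ w
  ⋆-identity-free ψ h w Mw = trans
    (⋆-cong w (λ {u} {v} i → cong (_* ψ v) (h u (proj₁ (Interleaving-All i Mw)))))
    (⋆-identityˡ ψ w)

  ⋆-zero-free : {φ ψ : Series X} → (∀ u → Free M u → φ u ≡ 0) → ∀ w → Free M w → (φ ⋆ ψ) w ≡ 0
  ⋆-zero-free h w Mw = ⋆-zeroˡ w (λ {u} i → h u (proj₁ (Interleaving-All i Mw)))

  -- A type I word that starts with its least letter is this letter followed by an arbitrary type I
  -- word.
  𝓕⁺-free-true : ∀ w → Free M w → 𝓕⁺ M true w ≡ 𝓔 w
  𝓕⁺-free-true w Mw with initLast w
  ... | [] = refl
  ... | w ∷ʳ′ t = trans (𝓕⁺-∷ʳ M true w t)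
    (trans (⋆-identity-free 𝓔⁺ 𝓕-free-true w (Allₚ.++⁻ˡ w Mw)) (sym (𝓔-∷ʳ w t)))

  -- The analogue of 𝓕⁺-∷ʳ for type II words on w ∷ʳ t and one smaller letter with mark b; unlike the former
  -- it is not obtained by cutting these words at the least letter.
  𝓟-∷ʳ : ∀ w b t → 𝓟 M b (w ∷ʳ t) ≡ (𝓛 M (M t) ⋆ 𝓔⁺) w
  𝓟-∷ʳ = length-ind _ step
    where
    step : ∀ w → (∀ v → length v < length w → ∀ b t → 𝓟 M b (v ∷ʳ t) ≡ (𝓛 M (M t) ⋆ 𝓔⁺) v) →
      ∀ b t → 𝓟 M b (w ∷ʳ t) ≡ (𝓛 M (M t) ⋆ 𝓔⁺) w
    step [] ih b t = trans (𝓟-∷ M b t []) (*-comm 1 ⟦ M t ⟧)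
    step (x ∷ w) ih b t = begin
      𝓟 M b (x ∷ (w ∷ʳ t))                                       ≡⟨ 𝓟-∷ M b x (w ∷ʳ t) ⟩
      (𝓔 ⋆ 𝓟 M (M x)) (w ∷ʳ t)                                   ≡⟨ ⋆-snoc 𝓔 _ w t ⟩
      ((λ u → 𝓔 (u ∷ʳ t)) ⋆ 𝓟 M (M x)) w + (𝓔 ⋆ (λ v → 𝓟 M (M x) (v ∷ʳ t))) w
        ≡⟨ cong₂ _+_ (⋆-ext (λ u → 𝓔-∷ʳ u t) (λ _ → refl) w)
                     (⋆-cong-≤ w (λ _ _ → refl) (λ v p → ih v (s≤s p) (M x) t)) ⟩
      -- The summands come from `t` going left or right. Reordered, they are the two Leibniz terms
      -- of `𝓛 M (M t) ⋆ 𝓔⁺` at `x`, since `∂ x` turns `𝓛` into `𝓟 M (M x)` and `𝓔⁺` into `𝓔 ⋆ 𝓔⁺`.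
      (𝓔⁺ ⋆ 𝓟 M (M x)) w + (𝓔 ⋆ (𝓛 M (M t) ⋆ 𝓔⁺)) w
        ≡⟨ cong₂ _+_ (⋆-comm 𝓔⁺ (𝓟 M (M x)) w) (⋆-left-comm 𝓔 (𝓛 M (M t)) 𝓔⁺ w) ⟩
      (𝓟 M (M x) ⋆ 𝓔⁺) w + (𝓛 M (M t) ⋆ (𝓔 ⋆ 𝓔⁺)) w
        ≡⟨ cong ((𝓟 M (M x) ⋆ 𝓔⁺) w +_) (⋆-ext (λ _ → refl) (λ v → 𝓔⁺-∷ x v) w) ⟨
      (𝓟 M (M x) ⋆ 𝓔⁺) w + (𝓛 M (M t) ⋆ ∂ x 𝓔⁺) w                ∎

  -- With ψ x = 𝓟 K (K x), 𝓐 and 𝓑 count by (F , NL) and by (L , grn): the greatest letter is not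
  -- part of the word, and the flag of 𝓑 is its mark under M.
  𝓐 : (X → Series X) → Series X
  𝓐 ψ = onCons 0 (λ x → 𝓕 M (M x) ⋆ ψ x)

  𝓑 : Bool → (X → Series X) → Series X
  𝓑 b ψ = onCons 0 (λ x → 𝓛 M b ⋆ ψ x)

-- Exchanging a marked letter with its neighbour

module _ (M : X → Bool) {m o : X} (Mm : M m ≡ true) (Mo : M o ≡ false) where

  Vanishing : Series X → Set
  Vanishing φ = ∀ u → Free M u → φ u ≡ 0

  ∂-vanishing : ∀ {x φ} → M x ≡ false → Vanishing φ → Vanishing (∂ x φ)
  ∂-vanishing Mx h u Mu = h _ (Mx ∷ Mu)

  -- Corrections stand on both sides in place of a subtraction: as the mark moves up, `𝓕` drops and
  -- `𝓛` grows, and in each use one of `φ₁`, `φ₂` is zero. The bound `l` allows the law to be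
  -- assumed for short words only.
  Exchange : ℕ → Series X → Series X → Series X → Set
  Exchange l φ φ₁ φ₂ = ∀ s t → Free M s → Free M t → length s + length t ≤ l →
    φ (s ++ m ∷ o ∷ t) + φ₁ (s ++ m ∷ t) ≡ φ (s ++ o ∷ m ∷ t) + φ₂ (s ++ m ∷ t)

  -- By the Leibniz rule: a marked letter contributes only through the left factor.
  ⋆-marked : ∀ {φ ψ} → Vanishing φ → ∀ {t} → Free M t → (φ ⋆ ψ) (m ∷ t) ≡ (∂ m φ ⋆ ψ) t
  ⋆-marked {φ} {ψ} φ0 {t} Mt = trans (cong ((∂ m φ ⋆ ψ) t +_) (⋆-zero-free M φ0 t Mt)) (+-identityʳ _)

  ⋆-marked-∷ʳ : ∀ {φ ψ} → Vanishing φ → ∀ {w} → Free M w → (φ ⋆ ψ) (w ∷ʳ m) ≡ ((λ u → φ (u ∷ʳ m)) ⋆ ψ) w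
  ⋆-marked-∷ʳ {φ} {ψ} φ0 {w} Mw = trans (⋆-snoc φ ψ w m)
    (trans (cong (((λ u → φ (u ∷ʳ m)) ⋆ ψ) w +_) (⋆-zero-free M φ0 w Mw)) (+-identityʳ _))

  -- Splits that send the marked letter right contribute nothing. If `m` goes left and `o` right,
  -- both sides have the same term; if both go left, the law for `φ` applies to the left subword.
  ⋆-exchange : ∀ s t {φ φ₁ φ₂} ψ → Free M s → Free M t → Vanishing φ → Vanishing φ₁ → Vanishing φ₂ →
    Exchange (length s + length t) φ φ₁ φ₂ →
    (φ ⋆ ψ) (s ++ m ∷ o ∷ t) + (φ₁ ⋆ ψ) (s ++ m ∷ t) ≡ (φ ⋆ ψ) (s ++ o ∷ m ∷ t) + (φ₂ ⋆ ψ) (s ++ m ∷ t)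
  ⋆-exchange [] t {φ} {φ₁} {φ₂} ψ _ Mt φ0 φ₁0 φ₂0 ex = begin
    (φ ⋆ ψ) (m ∷ o ∷ t) + (φ₁ ⋆ ψ) (m ∷ t)
      ≡⟨ cong₂ _+_ (⋆-marked {ψ = ψ} φ0 (Mo ∷ Mt)) (⋆-marked {ψ = ψ} φ₁0 Mt) ⟩
    ((∂ o (∂ m φ) ⋆ ψ) t + (∂ m φ ⋆ ∂ o ψ) t) + (∂ m φ₁ ⋆ ψ) t
      ≡⟨ +-swap ((∂ o (∂ m φ) ⋆ ψ) t) _ _ ⟩
    ((∂ o (∂ m φ) ⋆ ψ) t + (∂ m φ₁ ⋆ ψ) t) + (∂ m φ ⋆ ∂ o ψ) t
      ≡⟨ cong (_+ (∂ m φ ⋆ ∂ o ψ) t) (⋆-distribʳ (∂ o (∂ m φ)) (∂ m φ₁) ψ t) ⟨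
    ((λ u → ∂ o (∂ m φ) u + ∂ m φ₁ u) ⋆ ψ) t + (∂ m φ ⋆ ∂ o ψ) t
      ≡⟨ cong (_+ (∂ m φ ⋆ ∂ o ψ) t) (⋆-cong t (λ {u} {v} i → cong (_* ψ v)
           (ex [] u [] (proj₁ (Interleaving-All i Mt)) (proj₁ (Interleaving-length i))))) ⟩
    ((λ u → ∂ m (∂ o φ) u + ∂ m φ₂ u) ⋆ ψ) t + (∂ m φ ⋆ ∂ o ψ) t
      ≡⟨ cong (_+ (∂ m φ ⋆ ∂ o ψ) t) (⋆-distribʳ (∂ m (∂ o φ)) (∂ m φ₂) ψ t) ⟩
    ((∂ m (∂ o φ) ⋆ ψ) t + (∂ m φ₂ ⋆ ψ) t) + (∂ m φ ⋆ ∂ o ψ) t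
      ≡⟨ +-swap ((∂ m (∂ o φ) ⋆ ψ) t) _ _ ⟩
    ((∂ m (∂ o φ) ⋆ ψ) t + (∂ m φ ⋆ ∂ o ψ) t) + (∂ m φ₂ ⋆ ψ) t
      ≡⟨ cong₂ _+_ (cong₂ _+_ (⋆-marked {ψ = ψ} (∂-vanishing Mo φ0) Mt) (⋆-marked {ψ = ∂ o ψ} φ0 Mt))
                   (⋆-marked {ψ = ψ} φ₂0 Mt) ⟨
    (φ ⋆ ψ) (o ∷ m ∷ t) + (φ₂ ⋆ ψ) (m ∷ t) ∎
    where
    +-swap : ∀ a b c → (a + b) + c ≡ (a + c) + b
    +-swap = xy∙z≈xz∙y +-commutativeSemigroup
  ⋆-exchange (x ∷ s) t {φ} {φ₁} {φ₂} ψ (Mx ∷ Ms) Mt φ0 φ₁0 φ₂0 ex = begin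
    ((∂ x φ ⋆ ψ) (s ++ m ∷ o ∷ t) + (φ ⋆ ∂ x ψ) (s ++ m ∷ o ∷ t)) +
      ((∂ x φ₁ ⋆ ψ) (s ++ m ∷ t) + (φ₁ ⋆ ∂ x ψ) (s ++ m ∷ t))
      ≡⟨ +-interchange ((∂ x φ ⋆ ψ) (s ++ m ∷ o ∷ t)) _ _ _ ⟩
    ((∂ x φ ⋆ ψ) (s ++ m ∷ o ∷ t) + (∂ x φ₁ ⋆ ψ) (s ++ m ∷ t)) +
      ((φ ⋆ ∂ x ψ) (s ++ m ∷ o ∷ t) + (φ₁ ⋆ ∂ x ψ) (s ++ m ∷ t))
      ≡⟨ cong₂ _+_
           (⋆-exchange s t ψ Ms Mt (∂-vanishing Mx φ0) (∂-vanishing Mx φ₁0) (∂-vanishing Mx φ₂0)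
             (λ s′ t′ Ms′ Mt′ p → ex (x ∷ s′) t′ (Mx ∷ Ms′) Mt′ (s≤s p)))
           (⋆-exchange s t (∂ x ψ) Ms Mt φ0 φ₁0 φ₂0 (λ s′ t′ Ms′ Mt′ p → ex s′ t′ Ms′ Mt′ (m≤n⇒m≤1+n p))) ⟩
    ((∂ x φ ⋆ ψ) (s ++ o ∷ m ∷ t) + (∂ x φ₂ ⋆ ψ) (s ++ m ∷ t)) +
      ((φ ⋆ ∂ x ψ) (s ++ o ∷ m ∷ t) + (φ₂ ⋆ ∂ x ψ) (s ++ m ∷ t))
      ≡⟨ +-interchange ((∂ x φ ⋆ ψ) (s ++ o ∷ m ∷ t)) _ _ _ ⟩
    ((∂ x φ ⋆ ψ) (s ++ o ∷ m ∷ t) + (φ ⋆ ∂ x ψ) (s ++ o ∷ m ∷ t)) +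
      ((∂ x φ₂ ⋆ ψ) (s ++ m ∷ t) + (φ₂ ⋆ ∂ x ψ) (s ++ m ∷ t)) ∎

  -- A type I word ends in its greatest letter, which is therefore first only when it is alone.
  𝓕-∷ʳ-marked : ∀ u → Free M u → 𝓕 M false (u ∷ʳ m) ≡ δ u
  𝓕-∷ʳ-marked [] _ rewrite Mm = refl
  𝓕-∷ʳ-marked (x ∷ u) (Mx ∷ Mu) rewrite Mx = trans (𝓕⁺-∷ʳ M false u m) (⋆-zero-free M (𝓕-free M) u Mu)

  -- Deleting a final greatest letter leaves an arbitrary type II word. In `𝓟-∷ʳ` this appears as a
  -- left factor with flag `true` and no marked letter, that is `δ`.
  𝓛-∷ʳ-marked : ∀ u → Free M u → 𝓛 M false (u ∷ʳ m) ≡ 𝓔 u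
  𝓛-∷ʳ-marked [] _ rewrite Mm = refl
  𝓛-∷ʳ-marked (x ∷ u) (Mx ∷ Mu) rewrite 𝓟-∷ʳ M u (M x) m | Mm =
    ⋆-identity-free M 𝓔⁺ (𝓛-free-true M) u Mu

  module _ {ψ : X → Series X} (ψ-∷ : ∀ x y w → ψ x (y ∷ w) ≡ (𝓔 ⋆ ψ y) w) (ψ-mo : ∀ w → ψ m w ≡ ψ o w) where

    -- The pair consists of the two least letters. If `m` is the least, it is first only with an
    -- empty left part. If `o` is the least, the left part begins with its own least letter `m` and
    -- is otherwise arbitrary, which gives `𝓔`; unfolding `ψ m` at `o` produces the same product.
    𝓕-exchange-head : ∀ t → Free M t →
      (𝓕 M true ⋆ ψ m) (o ∷ t) ≡ (𝓕 M false ⋆ ψ o) (m ∷ t) + (𝓛 M false ⋆ ψ m) t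
    𝓕-exchange-head t Mt = begin
      (𝓕 M true ⋆ ψ m) (o ∷ t)                   ≡⟨ ⋆-identity-free M (ψ m) (𝓕-free-true M) (o ∷ t) (Mo ∷ Mt) ⟩
      ψ m (o ∷ t)                                ≡⟨ ψ-∷ m o t ⟩
      (𝓔 ⋆ ψ o) t
        ≡⟨ ⋆-cong t (λ {u} {v} i → cong (_* ψ o v) (lemma u (proj₁ (Interleaving-All i Mt)))) ⟨
      (∂ m (𝓕 M false) ⋆ ψ o) t                  ≡⟨ ⋆-marked {ψ = ψ o} (𝓕-free M) Mt ⟨
      (𝓕 M false ⋆ ψ o) (m ∷ t)                  ≡⟨ +-identityʳ _ ⟨
      (𝓕 M false ⋆ ψ o) (m ∷ t) + 0
        ≡⟨ cong ((𝓕 M false ⋆ ψ o) (m ∷ t) +_) (⋆-zero-free M (𝓛-free M) t Mt) ⟨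
      (𝓕 M false ⋆ ψ o) (m ∷ t) + (𝓛 M false ⋆ ψ m) t ∎
      where
      lemma : ∀ u → Free M u → 𝓕⁺ M (M m) u ≡ 𝓔 u
      lemma u Mu rewrite Mm = 𝓕⁺-free-true M u Mu

    -- A word ends in its least letter only if it has no other one, so the left factor is exactly
    -- `m` in the first product and empty in the correction. What remains is `ψ o t` against
    -- `ψ m t`, equal because the second marks of `m` and `o` agree.
    𝓛-exchange-head : ∀ t → Free M t →
      (𝓛 M false ⋆ ψ o) (m ∷ t) ≡ (𝓛 M false ⋆ ψ m) (o ∷ t) + (𝓕 M true ⋆ ψ m) t
    𝓛-exchange-head t Mt = begin
      (𝓛 M false ⋆ ψ o) (m ∷ t)                  ≡⟨ ⋆-marked {ψ = ψ o} (𝓛-free M) Mt ⟩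
      (∂ m (𝓛 M false) ⋆ ψ o) t                  ≡⟨ ⋆-identity-free M (ψ o) lemma t Mt ⟩
      ψ o t                                      ≡⟨ ψ-mo t ⟨
      ψ m t                                      ≡⟨ ⋆-identity-free M (ψ m) (𝓕-free-true M) t Mt ⟨
      (𝓕 M true ⋆ ψ m) t
        ≡⟨ cong (_+ (𝓕 M true ⋆ ψ m) t) (⋆-zero-free M (𝓛-free M) (o ∷ t) (Mo ∷ Mt)) ⟨
      (𝓛 M false ⋆ ψ m) (o ∷ t) + (𝓕 M true ⋆ ψ m) t ∎
      where
      lemma : ∀ u → Free M u → 𝓟 M (M m) u ≡ δ u
      lemma u Mu rewrite Mm = 𝓟-free-true M u Mu

  Exchange-𝓕𝓛 : List X → List X → Set
  Exchange-𝓕𝓛 s t =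
    (𝓕 M false (s ++ m ∷ o ∷ t) ≡ 𝓕 M false (s ++ o ∷ m ∷ t) + 𝓛 M false (s ++ m ∷ t)) ×
    (𝓛 M false (s ++ o ∷ m ∷ t) ≡ 𝓛 M false (s ++ m ∷ o ∷ t) + 𝓕 M false (s ++ m ∷ t))

  Exchange-𝓐𝓑 : (X → Series X) → List X → List X → Set
  Exchange-𝓐𝓑 ψ s t =
    (𝓐 M ψ (s ++ m ∷ o ∷ t) ≡ 𝓐 M ψ (s ++ o ∷ m ∷ t) + 𝓑 M false ψ (s ++ m ∷ t)) ×
    (𝓑 M false ψ (s ++ o ∷ m ∷ t) ≡ 𝓑 M false ψ (s ++ m ∷ o ∷ t) + 𝓐 M ψ (s ++ m ∷ t))

  module _ {ψ : X → Series X} (ψ-∷ : ∀ x y w → ψ x (y ∷ w) ≡ (𝓔 ⋆ ψ y) w) (ψ-mo : ∀ w → ψ m w ≡ ψ o w) where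

    -- A least letter `x` outside the pair stays untouched, and `⋆-exchange` acts on the rest.
    -- Leaving `ψ` general serves two purposes: `𝓔⁺` inside the induction for `𝓕` and `𝓛`, and
    -- `parent` for the matrices.
    lift-exchange : ∀ s t → Free M s → Free M t →
      (∀ s′ t′ → Free M s′ → Free M t′ → length s′ + length t′ < length s + length t → Exchange-𝓕𝓛 s′ t′) →
      Exchange-𝓐𝓑 ψ s t
    lift-exchange [] t _ Mt _ = subst₂
      (λ b b′ → ((𝓕 M b ⋆ ψ m) (o ∷ t) ≡ (𝓕 M b′ ⋆ ψ o) (m ∷ t) + (𝓛 M false ⋆ ψ m) t) ×
                ((𝓛 M false ⋆ ψ o) (m ∷ t) ≡ (𝓛 M false ⋆ ψ m) (o ∷ t) + (𝓕 M b ⋆ ψ m) t))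
      (sym Mm) (sym Mo) (𝓕-exchange-head ψ-∷ ψ-mo t Mt , 𝓛-exchange-head ψ-∷ ψ-mo t Mt)
    lift-exchange (x ∷ s) t (Mx ∷ Ms) Mt ex = subst
      (λ b → ((𝓕 M b ⋆ ψ x) (s ++ m ∷ o ∷ t) ≡ (𝓕 M b ⋆ ψ x) (s ++ o ∷ m ∷ t) + (𝓛 M false ⋆ ψ x) (s ++ m ∷ t)) ×
             ((𝓛 M false ⋆ ψ x) (s ++ o ∷ m ∷ t) ≡ (𝓛 M false ⋆ ψ x) (s ++ m ∷ o ∷ t) + (𝓕 M b ⋆ ψ x) (s ++ m ∷ t)))
      (sym Mx) (
      trans (sym (+-identityʳ _)) (trans (cong ((𝓕 M false ⋆ ψ x) (s ++ m ∷ o ∷ t) +_) (sym no-m))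
        (⋆-exchange s t (ψ x) Ms Mt (𝓕-free M) (λ _ _ → refl) (𝓛-free M)
          λ s′ t′ Ms′ Mt′ p → trans (+-identityʳ _) (proj₁ (ex s′ t′ Ms′ Mt′ (s≤s p))))) ,
      sym (trans (⋆-exchange s t (ψ x) Ms Mt (𝓛-free M) (𝓕-free M) (λ _ _ → refl)
          λ s′ t′ Ms′ Mt′ p → sym (trans (+-identityʳ _) (proj₂ (ex s′ t′ Ms′ Mt′ (s≤s p)))))
        (trans (cong ((𝓛 M false ⋆ ψ x) (s ++ o ∷ m ∷ t) +_) no-m) (+-identityʳ _))))
      where
      no-m : ((λ _ → 0) ⋆ ψ x) (s ++ m ∷ t) ≡ 0
      no-m = ⋆-zeroˡ (s ++ m ∷ t) (λ _ → refl)

  -- Here `m` and `o` are the two greatest letters, and splitting off the greatest one would break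
  -- the pair, so the values are computed outright. For `𝓛` they express that as many words end in
  -- the greatest letter as in the second greatest, once another letter is present.
  exchange-∷ʳ : ∀ s → Free M s → Exchange-𝓕𝓛 s []
  exchange-∷ʳ [] _ =
    subst (λ b → 𝓕⁺ M b (o ∷ []) ≡ 𝓕⁺ M (M o) (m ∷ []) + 𝓟 M b []) (sym Mm)
      (trans (𝓕⁺-free-true M (o ∷ []) (Mo ∷ []))
        (cong (_+ 1) (sym (subst (λ b → 𝓕⁺ M b (m ∷ []) ≡ 0) (sym Mo) (𝓕⁺-∷ʳ M false [] m))))) ,
    subst (λ b → 𝓟 M (M o) (m ∷ []) ≡ 𝓟 M b (o ∷ []) + 𝓕⁺ M b []) (sym Mm)
      (trans (𝓟-∷ʳ M [] (M o) m) (trans (subst (λ b → ⟦ b ⟧ * 1 ≡ 1) (sym Mm) refl)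
        (cong (_+ 1) (sym (𝓟-free-true M (o ∷ []) (Mo ∷ []))))))
  exchange-∷ʳ (x ∷ s) (Mx ∷ Ms) = 𝓕-case , 𝓛-case
    where
    𝓕-case : 𝓕⁺ M (M x) (s ++ m ∷ o ∷ []) ≡ 𝓕⁺ M (M x) (s ++ o ∷ m ∷ []) + 𝓟 M (M x) (s ∷ʳ m)
    𝓕-case = begin
      𝓕⁺ M (M x) (s ++ m ∷ o ∷ [])         ≡⟨ cong₂ (𝓕⁺ M) Mx (sym (++-assoc s [ m ] [ o ])) ⟩
      𝓕⁺ M false ((s ∷ʳ m) ∷ʳ o)           ≡⟨ 𝓕⁺-∷ʳ M false (s ∷ʳ m) o ⟩
      (𝓕 M false ⋆ 𝓔⁺) (s ∷ʳ m)            ≡⟨ ⋆-marked-∷ʳ {ψ = 𝓔⁺} (𝓕-free M) Ms ⟩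
      ((λ u → 𝓕 M false (u ∷ʳ m)) ⋆ 𝓔⁺) s  ≡⟨ ⋆-identity-free M 𝓔⁺ 𝓕-∷ʳ-marked s Ms ⟩
      𝓔⁺ s                                 ≡⟨ 𝓛-∷ʳ-marked (x ∷ s) (Mx ∷ Ms) ⟨
      𝓟 M (M x) (s ∷ʳ m)                   ≡⟨⟩
      0 + 𝓟 M (M x) (s ∷ʳ m)
        ≡⟨ cong (_+ 𝓟 M (M x) (s ∷ʳ m)) (𝓕-∷ʳ-marked (x ∷ (s ∷ʳ o)) (Mx ∷ Allₚ.++⁺ Ms (Mo ∷ []))) ⟨
      𝓕⁺ M (M x) ((s ∷ʳ o) ∷ʳ m) + 𝓟 M (M x) (s ∷ʳ m)
        ≡⟨ cong (λ u → 𝓕⁺ M (M x) u + 𝓟 M (M x) (s ∷ʳ m)) (++-assoc s [ o ] [ m ]) ⟩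
      𝓕⁺ M (M x) (s ++ o ∷ m ∷ []) + 𝓟 M (M x) (s ∷ʳ m) ∎
    𝓛-case : 𝓟 M (M x) (s ++ o ∷ m ∷ []) ≡ 𝓟 M (M x) (s ++ m ∷ o ∷ []) + 𝓕⁺ M (M x) (s ∷ʳ m)
    𝓛-case = begin
      𝓟 M (M x) (s ++ o ∷ m ∷ [])          ≡⟨ cong (𝓟 M (M x)) (++-assoc s [ o ] [ m ]) ⟨
      𝓟 M (M x) ((s ∷ʳ o) ∷ʳ m)            ≡⟨ 𝓛-∷ʳ-marked (x ∷ (s ∷ʳ o)) (Mx ∷ Allₚ.++⁺ Ms (Mo ∷ [])) ⟩
      𝓔⁺ (s ∷ʳ o)                          ≡⟨ 𝓔⁺-cong (s ∷ʳ o) (o ∷ s) (length-∷ʳ s o) ⟩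
      𝓔⁺ (o ∷ s)                           ≡⟨ 𝓔⁺-∷ o s ⟩
      (𝓔 ⋆ 𝓔⁺) s
        ≡⟨ ⋆-cong s (λ {u} {v} i → cong (_* 𝓔⁺ v) (𝓛-∷ʳ-marked u (proj₁ (Interleaving-All i Ms)))) ⟨
      ((λ u → 𝓛 M false (u ∷ʳ m)) ⋆ 𝓔⁺) s  ≡⟨ ⋆-marked-∷ʳ {ψ = 𝓔⁺} (𝓛-free M) Ms ⟨
      (𝓛 M false ⋆ 𝓔⁺) (s ∷ʳ m)
        ≡⟨ subst (λ b → 𝓟 M (M x) ((s ∷ʳ m) ∷ʳ o) ≡ (𝓛 M b ⋆ 𝓔⁺) (s ∷ʳ m)) Mo (𝓟-∷ʳ M (s ∷ʳ m) (M x) o) ⟨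
      𝓟 M (M x) ((s ∷ʳ m) ∷ʳ o)            ≡⟨ cong (𝓟 M (M x)) (++-assoc s [ m ] [ o ]) ⟩
      𝓟 M (M x) (s ++ m ∷ o ∷ [])          ≡⟨ +-identityʳ _ ⟨
      𝓟 M (M x) (s ++ m ∷ o ∷ []) + 0
        ≡⟨ cong (𝓟 M (M x) (s ++ m ∷ o ∷ []) +_) (𝓕-∷ʳ-marked (x ∷ s) (Mx ∷ Ms)) ⟨
      𝓟 M (M x) (s ++ m ∷ o ∷ []) + 𝓕⁺ M (M x) (s ∷ʳ m) ∎

  private
    𝓔⁺ψ : X → Series X
    𝓔⁺ψ _ = 𝓔⁺

    𝓕-max : ∀ s t x z → 𝓕 M false (s ++ x ∷ (t ∷ʳ z)) ≡ 𝓐 M 𝓔⁺ψ (s ++ x ∷ t)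
    𝓕-max [] t x z = 𝓕⁺-∷ʳ M (M x) t z
    𝓕-max (y ∷ s) t x z = trans (cong (𝓕⁺ M (M y)) (sym (++-assoc s (x ∷ t) [ z ])))
      (𝓕⁺-∷ʳ M (M y) (s ++ x ∷ t) z)

    𝓛-max : ∀ s t x {z} → M z ≡ false → 𝓛 M false (s ++ x ∷ (t ∷ʳ z)) ≡ 𝓑 M false 𝓔⁺ψ (s ++ x ∷ t)
    𝓛-max [] t x {z} Mz = trans (𝓟-∷ʳ M t (M x) z) (cong (λ b → (𝓛 M b ⋆ 𝓔⁺) t) Mz)
    𝓛-max (y ∷ s) t x {z} Mz = trans (cong (𝓟 M (M y)) (sym (++-assoc s (x ∷ t) [ z ])))
      (trans (𝓟-∷ʳ M (s ++ x ∷ t) (M y) z) (cong (λ b → (𝓛 M b ⋆ 𝓔⁺) (s ++ x ∷ t)) Mz))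

  -- The one-variable Entringer recurrences. The greatest letter is split off the word, and 𝓐 and 𝓑 with
  -- the right factor 𝓔⁺ are then handled by induction.
  exchange-𝓕𝓛 : ∀ s t → Free M s → Free M t → Exchange-𝓕𝓛 s t
  exchange-𝓕𝓛 s t = go (suc (length s + length t)) s t ≤-refl
    where
    go : ∀ n s t → length s + length t < n → Free M s → Free M t → Exchange-𝓕𝓛 s t
    go (suc n) s t (s≤s p) Ms Mt with initLast t
    ... | [] = exchange-∷ʳ s Ms
    ... | t ∷ʳ′ z with Allₚ.++⁻ʳ t Mt
    ... | Mz ∷ [] =
      let smaller : length s + length t < length s + length (t ∷ʳ z)
          smaller = +-monoʳ-< (length s) (<-∷ʳ t {v = t} ≤-refl)
          p , q = lift-exchange {𝓔⁺ψ} (λ _ y w → 𝓔⁺-∷ y w) (λ _ → refl) s t Ms (Allₚ.++⁻ˡ t Mt)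
                    (λ s′ t′ Ms′ Mt′ r → go n s′ t′ (<-≤-trans r (≤-trans (<⇒≤ smaller) p)) Ms′ Mt′)
      in trans (𝓕-max s (o ∷ t) m z)
           (trans p (sym (cong₂ _+_ (𝓕-max s (m ∷ t) o z) (𝓛-max s t m Mz)))) ,
         trans (𝓛-max s (m ∷ t) o Mz)
           (trans q (sym (cong₂ _+_ (𝓛-max s (o ∷ t) m Mz) (𝓕-max s t m z))))

  exchange-𝓐𝓑 : ∀ {ψ} → (∀ x y w → ψ x (y ∷ w) ≡ (𝓔 ⋆ ψ y) w) → (∀ w → ψ m w ≡ ψ o w) →
    ∀ s t → Free M s → Free M t → Exchange-𝓐𝓑 ψ s t
  exchange-𝓐𝓑 ψ-∷ ψ-mo s t Ms Mt = lift-exchange ψ-∷ ψ-mo s t Ms Mt (λ s′ t′ Ms′ Mt′ _ → exchange-𝓕𝓛 s′ t′ Ms′ Mt′)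

≡ᵇ-false : ∀ {x y} → x ≢ y → (x ≡ᵇ y) ≡ false
≡ᵇ-false {x} {y} = dec-false (x ≟ y)

≡ᵇ-refl : ∀ x → (x ≡ᵇ x) ≡ true
≡ᵇ-refl x = dec-true (x ≟ x) refl

-- The matrix entries. The letter x + 1 carries the marks (x = i , x = κ), so α N i κ and β N i κ are the
-- entries with index (i + 1 , κ + 1) of the matrices of dimension N + 1.

marks : ℕ → ℕ → ℕ → List (Bool × Bool)
marks N i κ = applyUpTo (λ x → (x ≡ᵇ i) , (x ≡ᵇ κ)) N

parent : Bool × Bool → Series (Bool × Bool)
parent x = 𝓟 proj₂ (proj₂ x)

α β : ℕ → ℕ → ℕ → ℕ
α N i κ = 𝓐 proj₁ parent (marks N i κ)
β N i κ = 𝓑 proj₁ (N ≡ᵇ i) parent (marks N i κ)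

-- The common column sum of both matrices of dimension `N + 1`, as `𝓟` counts by `NL` and by `grn`
-- alike. The flag is `false` because the outer value 0 is never `κ + 1`.
π : ℕ → ℕ → ℕ
π N κ = 𝓟 id false (applyUpTo (_≡ᵇ κ) N)

-- Boundary values of the entries

module _ (P Q : ℕ → Bool) (N : ℕ) where

  free₁ : (∀ {x} → x < N → P x ≡ false) → Free proj₁ (applyUpTo (λ x → P x , Q x) N)
  free₁ = Allₚ.applyUpTo⁺₁ _ N

  free₂ : (∀ {x} → x < N → Q x ≡ false) → Free proj₂ (applyUpTo (λ x → P x , Q x) N)
  free₂ = Allₚ.applyUpTo⁺₁ _ N

  𝓟-proj₂ : ∀ b → 𝓟 proj₂ b (applyUpTo (λ x → P x , Q x) N) ≡ 𝓟 id b (applyUpTo Q N)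
  𝓟-proj₂ b = trans (sym (𝓟-map proj₂ id (applyUpTo (λ x → P x , Q x) N) b)) (cong (𝓟 id b) (map-applyUpTo (λ x → P x , Q x) proj₂ N))

  parent-only : {φ : Series (Bool × Bool)} → (∀ u → Free proj₁ u → φ u ≡ δ u) →
    (∀ {x} → x < N → P x ≡ false) → ∀ b →
    (φ ⋆ 𝓟 proj₂ b) (applyUpTo (λ x → P x , Q x) N) ≡ 𝓟 id b (applyUpTo Q N)
  parent-only h P0 b = trans (⋆-identity-free proj₁ (𝓟 proj₂ b) h _ (free₁ P0)) (𝓟-proj₂ b)

<⇒≡ᵇ-false : ∀ {x y} → x < y → (x ≡ᵇ y) ≡ false
<⇒≡ᵇ-false x<y = ≡ᵇ-false (<⇒≢ x<y)

>⇒≡ᵇ-false : ∀ {x y} → y < x → (x ≡ᵇ y) ≡ false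
>⇒≡ᵇ-false y<x = ≡ᵇ-false (>⇒≢ y<x)

α-first : ∀ N κ → α (suc N) 0 (suc κ) ≡ π N κ
α-first N κ = parent-only (λ _ → false) (_≡ᵇ κ) N (𝓕-free-true proj₁) (λ _ → refl) false

β-last : ∀ N κ → β (suc N) (suc N) (suc κ) ≡ π N κ
β-last N κ rewrite ≡ᵇ-refl N =
  parent-only (_≡ᵇ N) (_≡ᵇ κ) N (𝓛-free-true proj₁) <⇒≡ᵇ-false false

-- If n is last with 1 as its larger neighbour, the right part of the cut at 1 is n alone. It must
-- contain the second least letter, which is impossible from dimension 3 on.
β-last-1 : ∀ N → β (2 + N) (2 + N) 0 ≡ 0
β-last-1 N rewrite ≡ᵇ-refl N = trans
  (parent-only (_≡ᵇ suc N) (λ _ → false) (suc N) (𝓛-free-true proj₁) <⇒≡ᵇ-false true)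
  (𝓟-free-true id (applyUpTo (λ _ → false) (suc N)) (Allₚ.applyUpTo⁺₁ _ (suc N) (λ _ → refl)))

⋆-no-parent : (φ : Series (Bool × Bool)) (N i : ℕ) →
  (φ ⋆ 𝓟 proj₂ false) (applyUpTo (λ x → (suc x ≡ᵇ i) , (x ≡ᵇ N)) N) ≡ 0
⋆-no-parent φ N i = trans (⋆-comm φ (𝓟 proj₂ false) (applyUpTo (λ x → (suc x ≡ᵇ i) , (x ≡ᵇ N)) N))
  (⋆-zero-free proj₂ {ψ = φ} (𝓟-free proj₂) _ (free₂ (λ x → suc x ≡ᵇ i) (_≡ᵇ N) N <⇒≡ᵇ-false))

α-col-last : ∀ N i → α (suc N) i (suc N) ≡ 0
α-col-last N i = ⋆-no-parent (𝓕 proj₁ (0 ≡ᵇ i)) N i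

β-col-last : ∀ N i → β (suc N) i (suc N) ≡ 0
β-col-last N i = ⋆-no-parent (𝓛 proj₁ (suc N ≡ᵇ i)) N i

α-row-last : ∀ N κ → α (suc N) (suc N) κ ≡ 0
α-row-last N κ = ⋆-zero-free proj₁ (𝓕-free proj₁) (applyUpTo (λ x → (x ≡ᵇ N) , (suc x ≡ᵇ κ)) N)
  (free₁ (_≡ᵇ N) (λ x → suc x ≡ᵇ κ) N <⇒≡ᵇ-false)

β-row-first : ∀ N κ → β (suc N) 0 κ ≡ 0
β-row-first N κ = ⋆-zero-free proj₁ (𝓛-free proj₁) (applyUpTo (λ x → false , (suc x ≡ᵇ κ)) N)
  (free₁ (λ _ → false) (λ x → suc x ≡ᵇ κ) N (λ _ → refl))

-- The only marked letter carries both marks, but each mark is needed in a different factor.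
⋆-diagonal : ∀ N i {φ ψ : Series (Bool × Bool)} → (∀ u → Free proj₁ u → φ u ≡ 0) →
  (∀ u → Free proj₂ u → ψ u ≡ 0) → (φ ⋆ ψ) (marks N i i) ≡ 0
⋆-diagonal zero i {ψ = ψ} φ0 ψ0 = cong (_* ψ []) (φ0 [] [])
⋆-diagonal (suc N) zero {φ} {ψ} φ0 ψ0 = cong₂ _+_
  (trans (⋆-comm _ ψ unmarked) (⋆-zero-free proj₂ ψ0 unmarked (free₂ (λ _ → false) (λ _ → false) N (λ _ → refl))))
  (⋆-zero-free proj₁ φ0 unmarked (free₁ (λ _ → false) (λ _ → false) N (λ _ → refl)))
  where
  unmarked : List (Bool × Bool)
  unmarked = applyUpTo (λ _ → false , false) N
⋆-diagonal (suc N) (suc i) φ0 ψ0 = cong₂ _+_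
  (⋆-diagonal N i (λ u Mu → φ0 _ (refl ∷ Mu)) ψ0)
  (⋆-diagonal N i φ0 (λ u Ku → ψ0 _ (refl ∷ Ku)))

-- Dimension 3 is the first one covered: in dimension 2 the word 1 2 has both statistics equal to 1.
α-diagonal : ∀ N i → α (2 + N) i i ≡ 0
α-diagonal N zero = trans
  (parent-only (λ _ → false) (λ _ → false) (suc N) (𝓕-free-true proj₁) (λ _ → refl) true)
  (𝓟-free-true id (applyUpTo (λ _ → false) (suc N)) (Allₚ.applyUpTo⁺₁ _ (suc N) (λ _ → refl)))
α-diagonal N (suc i) = ⋆-diagonal (suc N) i (𝓕-free proj₁) (𝓟-free proj₂)

β-diagonal : ∀ N i → i < suc N → β (suc N) i i ≡ 0
β-diagonal N zero _ = β-row-first N 0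
β-diagonal N (suc i) (s≤s i<N) = trans
  (cong (λ b → (𝓛 proj₁ b ⋆ 𝓟 proj₂ false) (marks N i i)) (>⇒≡ᵇ-false i<N))
  (⋆-diagonal N i (𝓛-free proj₁) (𝓟-free proj₂))

module _ (N κ : ℕ) (κ<N : κ < suc N) where

  private
    w : List (Bool × Bool)
    w = applyUpTo (λ x → (x ≡ᵇ N) , (suc x ≡ᵇ κ)) N

    w-free : Free proj₁ w
    w-free = free₁ (_≡ᵇ N) (λ x → suc x ≡ᵇ κ) N <⇒≡ᵇ-false

    split-last : marks (2 + N) (suc N) κ ≡ (false , (0 ≡ᵇ κ)) ∷ (w ∷ʳ (true , false))
    split-last = cong ((false , (0 ≡ᵇ κ)) ∷_) (trans (sym (applyUpTo-∷ʳ _ N))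
      (cong (w ∷ʳ_) (cong₂ _,_ (≡ᵇ-refl N) (>⇒≡ᵇ-false κ<N))))

  -- The marked letter is the last of the list and its upper neighbour is the greatest letter, which
  -- the list omits, so the exchange law does not reach this row. The left part must end in its
  -- greatest letter; deleting it leaves the unfolding of `𝓟`.
  β-row-penultimate : β (2 + N) (suc N) κ ≡ π (suc N) κ
  β-row-penultimate = begin
    β (2 + N) (suc N) κ
      ≡⟨ cong₂ (λ b → 𝓑 proj₁ b parent) (>⇒≡ᵇ-false (n<1+n N)) split-last ⟩
    (𝓛 proj₁ false ⋆ 𝓟 proj₂ (0 ≡ᵇ κ)) (w ∷ʳ (true , false))
      ≡⟨ ⋆-marked-∷ʳ proj₁ {true , false} {false , false} refl refl {ψ = 𝓟 proj₂ (0 ≡ᵇ κ)} (𝓛-free proj₁) w-free ⟩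
    ((λ u → 𝓛 proj₁ false (u ∷ʳ (true , false))) ⋆ 𝓟 proj₂ (0 ≡ᵇ κ)) w
      ≡⟨ ⋆-cong w (λ {u} {v} i → cong (_* 𝓟 proj₂ (0 ≡ᵇ κ) v)
           (𝓛-∷ʳ-marked proj₁ {true , false} {false , false} refl refl u (proj₁ (Interleaving-All i w-free)))) ⟩
    (𝓔 ⋆ 𝓟 proj₂ (0 ≡ᵇ κ)) w
      ≡⟨ 𝓟-∷ proj₂ false (false , (0 ≡ᵇ κ)) w ⟨
    𝓟 proj₂ false ((false , (0 ≡ᵇ κ)) ∷ w)
      ≡⟨ 𝓟-proj₂ (_≡ᵇ suc N) (_≡ᵇ κ) (suc N) false ⟩
    π (suc N) κ ∎

  -- On the left the marked letter, greatest in its part, must stand there alone; on the right the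
  -- greatest letter is last only if the left factor is empty. Both left factors become `δ` on `w`.
  α-row-penultimate : α (2 + N) (suc N) κ ≡ β (suc N) (suc N) κ
  α-row-penultimate = begin
    α (2 + N) (suc N) κ
      ≡⟨ cong (𝓐 proj₁ parent) split-last ⟩
    (𝓕 proj₁ false ⋆ 𝓟 proj₂ (0 ≡ᵇ κ)) (w ∷ʳ (true , false))
      ≡⟨ ⋆-marked-∷ʳ proj₁ {true , false} {false , false} refl refl {ψ = 𝓟 proj₂ (0 ≡ᵇ κ)} (𝓕-free proj₁) w-free ⟩
    ((λ u → 𝓕 proj₁ false (u ∷ʳ (true , false))) ⋆ 𝓟 proj₂ (0 ≡ᵇ κ)) w
      ≡⟨ ⋆-cong w (λ {u} {v} i → cong (_* 𝓟 proj₂ (0 ≡ᵇ κ) v)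
           (trans (𝓕-∷ʳ-marked proj₁ {true , false} {false , false} refl refl u (proj₁ (Interleaving-All i w-free)))
                  (sym (𝓛-free-true proj₁ u (proj₁ (Interleaving-All i w-free)))))) ⟩
    (𝓛 proj₁ true ⋆ 𝓟 proj₂ (0 ≡ᵇ κ)) w
      ≡⟨ cong (λ b → (𝓛 proj₁ b ⋆ 𝓟 proj₂ (0 ≡ᵇ κ)) w) (≡ᵇ-refl N) ⟨
    β (suc N) (suc N) κ ∎

-- The recurrences of the entries

pattern ● = true , false
pattern ○ = false , false

-- Here `Q′` is `Q` after one letter of the pair is deleted. As `●` and `○` have second component
-- `false`, the column mark must avoid both `i` and `i + 1`; this is what separates the range above
-- the diagonal from the one below.
record Neighbours (i l : ℕ) (Q Q′ : ℕ → Bool) : Set where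
  constructor neighbours
  field
    {s t}      : List (Bool × Bool)
    s-free     : Free proj₁ s
    t-free     : Free proj₁ t
    marked-i   : applyUpTo (λ x → (x ≡ᵇ i) , Q x) (2 + i + l) ≡ s ++ ● ∷ ○ ∷ t
    marked-1+i : applyUpTo (λ x → (x ≡ᵇ suc i) , Q x) (2 + i + l) ≡ s ++ ○ ∷ ● ∷ t
    collapsed  : applyUpTo (λ x → (x ≡ᵇ i) , Q′ x) (1 + i + l) ≡ s ++ ● ∷ t

applyUpTo-cong : {A : Set} {f g : ℕ → A} → (∀ x → f x ≡ g x) → ∀ n → applyUpTo f n ≡ applyUpTo g n
applyUpTo-cong h zero    = refl
applyUpTo-cong h (suc n) = cong₂ _∷_ (h 0) (applyUpTo-cong (h ∘ suc) n)

find-neighbours : ∀ i l (Q Q′ : ℕ → Bool) → (∀ x → x < i → Q x ≡ Q′ x) → Q i ≡ false → Q (suc i) ≡ false →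
  Q′ i ≡ false → (∀ x → Q (2 + i + x) ≡ Q′ (1 + i + x)) → Neighbours i l Q Q′
find-neighbours zero l Q Q′ _ Q0 Q1 Q′0 h = neighbours [] (free₁ (λ _ → false) (λ x → Q (2 + x)) l (λ _ → refl))
  (cong₂ (λ b b′ → (true , b) ∷ (false , b′) ∷ applyUpTo (λ x → false , Q (2 + x)) l) Q0 Q1)
  (cong₂ (λ b b′ → (false , b) ∷ (true , b′) ∷ applyUpTo (λ x → false , Q (2 + x)) l) Q0 Q1)
  (cong₂ (λ b t → (true , b) ∷ t) Q′0 (applyUpTo-cong (λ x → cong (false ,_) (sym (h x))) l))
find-neighbours (suc i) l Q Q′ same Qi Q1+i Q′i h
  with find-neighbours i l (Q ∘ suc) (Q′ ∘ suc) (λ x p → same (suc x) (s≤s p)) Qi Q1+i Q′i h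
... | neighbours s-free t-free p q r = neighbours (refl ∷ s-free) t-free
  (cong ((false , Q 0) ∷_) p) (cong ((false , Q 0) ∷_) q)
  (cong₂ _∷_ (cong (false ,_) (sym (same 0 (s≤s z≤n)))) r)

exchange : ∀ i l κ κ′ → Neighbours i l (_≡ᵇ κ) (_≡ᵇ κ′) →
  (α (2 + i + l) i κ ≡ α (2 + i + l) (suc i) κ + β (1 + i + l) i κ′) ×
  (β (2 + i + l) (suc i) κ ≡ β (2 + i + l) i κ + α (1 + i + l) i κ′)
exchange i l κ κ′ (neighbours {s} {t} s-free t-free p q r)
  with exchange-𝓐𝓑 proj₁ {●} {○} refl refl {parent}
         (λ x y w → 𝓟-∷ proj₂ (proj₂ x) y w) (λ _ → refl) s t s-free t-free
... | a , b =
  trans (cong (𝓐 proj₁ parent) p) (trans a (sym (cong₂ _+_ (cong (𝓐 proj₁ parent) q)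
    (cong₂ (λ b → 𝓑 proj₁ b parent) (>⇒≡ᵇ-false {suc (i + l)} (s≤s (m≤m+n i l))) r)))) ,
  trans (cong₂ (λ b → 𝓑 proj₁ b parent) (>⇒≡ᵇ-false {suc (i + l)} (s≤s (m≤m+n i l))) q)
    (trans b (sym (cong₂ _+_
      (cong₂ (λ b → 𝓑 proj₁ b parent) (>⇒≡ᵇ-false {2 + (i + l)} (m≤n⇒m≤1+n (s≤s (m≤m+n i l)))) p)
      (cong (𝓐 proj₁ parent) r))))

-- The deleted letter lies below the column mark, whose index drops by one: this is the k - 1 of
-- `ts4d` and `ts5b`.
neighbours-above : ∀ i l κ → suc i ≤ κ → Neighbours i l (_≡ᵇ suc κ) (_≡ᵇ κ)
neighbours-above i l κ i<κ = find-neighbours i l _ _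
  (λ x x<i → trans (<⇒≡ᵇ-false (<-trans x<i (m≤n⇒m≤1+n i<κ))) (sym (<⇒≡ᵇ-false (<-trans x<i i<κ))))
  (<⇒≡ᵇ-false (m≤n⇒m≤1+n i<κ)) (<⇒≡ᵇ-false i<κ) (<⇒≡ᵇ-false i<κ) (λ _ → refl)

neighbours-below : ∀ i l κ → κ < i → Neighbours i l (_≡ᵇ κ) (_≡ᵇ κ)
neighbours-below i l κ κ<i = find-neighbours i l _ _ (λ _ _ → refl)
  (>⇒≡ᵇ-false κ<i) (>⇒≡ᵇ-false (m≤n⇒m≤1+n κ<i)) (>⇒≡ᵇ-false κ<i)
  (λ x → trans (>⇒≡ᵇ-false (m≤n⇒m≤1+n (m≤n⇒m≤1+n (≤-trans κ<i (m≤m+n i x)))))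
               (sym (>⇒≡ᵇ-false (m≤n⇒m≤1+n (≤-trans κ<i (m≤m+n i x))))))

open Equivalence using (to; from)

-- Counting

-- `HasCount` over an arbitrary type, because cutting a word produces a pair of words.
HC : (A → Set) → ℕ → Set
HC {A} P c = Σ (List A) λ ws → Unique ws × (∀ w → (w ∈ ws) ⇔ P w) × length ws ≡ c

hc-cong : {P Q : A → Set} {c d : ℕ} → (∀ {w} → P w → Q w) → (∀ {w} → Q w → P w) → c ≡ d → HC P c → HC Q d
hc-cong f g refl (ws , u , h , l) = ws , u , (λ w → mk⇔ (f ∘ to (h w)) (from (h w) ∘ g)) , l

hc-unique : {P : A → Set} {c d : ℕ} → HC P c → HC P d → c ≡ d
hc-unique (ws , u , h , l) (ws′ , u′ , h′ , l′) = trans (sym l) (trans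
  (↭-length (∼bag⇒↭ (unique∧set⇒bag u u′ (λ {w} → mk⇔ (from (h′ w) ∘ to (h w)) (from (h w) ∘ to (h′ w))))))
  l′)

hc-empty : {P : A → Set} → (∀ {w} → ¬ P w) → HC P 0
hc-empty ¬P = [] , [] , (λ w → mk⇔ (λ ()) (⊥-elim ∘ ¬P)) , refl

hc-single : {P : A → Set} (a : A) (b : Bool) → (∀ {w} → P w → w ≡ a × b ≡ true) → (b ≡ true → P a) → HC P ⟦ b ⟧
hc-single a false h _ = hc-empty (λ p → case proj₂ (h p) of λ ())
hc-single a true h h′ = [ a ] , [] ∷ [] ,
  (λ w → mk⇔ (λ { (here refl) → h′ refl ; (there ()) }) (λ p → here (proj₁ (h p)))) , refl

hc-⊎ : {P Q : A → Set} {c d : ℕ} → (∀ {w} → P w → ¬ Q w) → HC P c → HC Q d → HC (λ w → P w ⊎ Q w) (c + d)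
hc-⊎ disjoint (ws , u , h , refl) (ws′ , u′ , h′ , refl) = ws ++ ws′ ,
  Uniqueₚ.++⁺ u u′ (λ {w} (p , q) → disjoint (to (h w) p) (to (h′ w) q)) ,
  (λ w → mk⇔ (λ p → [ inj₁ ∘ to (h w) , inj₂ ∘ to (h′ w) ]′ (∈-++⁻ ws p))
             [ ∈-++⁺ˡ ∘ from (h w) , ∈-++⁺ʳ ws ∘ from (h′ w) ]′) ,
  length-++ ws

length-cartesianProduct : (xs : List A) (ys : List B) → length (cartesianProduct xs ys) ≡ length xs * length ys
length-cartesianProduct [] ys = refl
length-cartesianProduct (x ∷ xs) ys = trans (length-++ (map (x ,_) ys))
  (cong₂ _+_ (length-map (x ,_) ys) (length-cartesianProduct xs ys))

hc-× : {P : A → Set} {Q : B → Set} {c d : ℕ} → HC P c → HC Q d → HC (λ (v , v′) → P v × Q v′) (c * d)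
hc-× (ws , u , h , refl) (ws′ , u′ , h′ , refl) = cartesianProduct ws ws′ , Uniqueₚ.cartesianProduct⁺ u u′ ,
  (λ (v , v′) → mk⇔ (λ p → let q , q′ = ∈-cartesianProduct⁻ ws ws′ p in to (h v) q , to (h′ v′) q′)
                    (λ (p , p′) → ∈-cartesianProduct⁺ (from (h v) p) (from (h′ v′) p′))) ,
  length-cartesianProduct ws ws′

hc-image : {P : A → Set} {c : ℕ} (f : A → B) → (∀ {a b} → P a → P b → f a ≡ f b → a ≡ b) →
  HC P c → HC (λ b → ∃ λ a → b ≡ f a × P a) c
hc-image {P = P} f inj (ws , u , h , l) = map f ws , unique-map (All.tabulate (λ {w} → to (h w))) u ,
  (λ b → mk⇔ (λ p → let a , a∈ , eq = ∈-map⁻ f p in a , eq , to (h a) a∈)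
             (λ (a , eq , p) → subst (_∈ map f ws) (sym eq) (∈-map⁺ f (from (h a) p)))) ,
  trans (length-map f ws) l
  where
  unique-map : ∀ {xs} → All P xs → Unique xs → Unique (map f xs)
  unique-map [] [] = []
  unique-map (p ∷ ps) (x∉ ∷ u) =
    Allₚ.map⁺ (All.zipWith (λ (q , x≢y) eq → x≢y (inj p q eq)) (ps , x∉)) ∷ unique-map ps u

hc-sum : {P : A → Set} (g : A → ℕ) (c : ℕ → ℕ) (js : List ℕ) → Unique js →
  (∀ {j} → j ∈ js → HC (λ w → P w × g w ≡ j) (c j)) → HC (λ w → P w × g w ∈ js) (sum (map c js))
hc-sum g c [] _ _ = hc-empty λ ()
hc-sum g c (j ∷ js) (j∉ ∷ u) h = hc-cong
  [ (λ (p , eq) → p , here eq) , (λ (p , q) → p , there q) ]′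
  (λ { (p , here eq) → inj₁ (p , eq) ; (p , there q) → inj₂ (p , q) }) refl
  (hc-⊎ (λ (_ , eq) (_ , q) → All.lookup j∉ (subst (_∈ js) eq q) refl)
        (h (here refl)) (hc-sum g c js u (h ∘ there)))

Split : (List X → A → Set) → (List X → B → Set) → List X → A × B → Set
Split P Q ys (v , v′) = ∃₂ λ u u′ → Interleaving u u′ ys × P u v × Q u′ v′

-- The two Leibniz terms count the splits with the first letter on the left and on the right. That
-- `v` determines `u` makes these cases disjoint.
hc-⋆ : (ys : List X) (P : List X → A → Set) (Q : List X → B → Set) {φ ψ : Series X} → Unique ys →
  (∀ {u u′ v} → P u v → P u′ v → u ≡ u′) →
  (∀ {u u′} → Interleaving u u′ ys → HC (P u) (φ u)) → (∀ {u u′} → Interleaving u u′ ys → HC (Q u′) (ψ u′)) →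
  HC (Split P Q ys) ((φ ⋆ ψ) ys)
hc-⋆ [] P Q _ _ hP hQ = hc-cong (λ (p , q) → [] , [] , [] , p , q) (λ { (_ , _ , [] , p , q) → p , q }) refl
  (hc-× (hP []) (hQ []))
hc-⋆ (y ∷ ys) P Q (y∉ ∷ u) inj hP hQ = hc-cong
  [ (λ (u , u′ , i , p , q) → y ∷ u , u′ , consˡ i , p , q) ,
    (λ (u , u′ , i , p , q) → u , y ∷ u′ , consʳ i , p , q) ]′
  (λ { (_ , _ , consˡ i , p , q) → inj₁ (_ , _ , i , p , q) ; (_ , _ , consʳ i , p , q) → inj₂ (_ , _ , i , p , q) })
  refl
  (hc-⊎ (λ { (_ , _ , _ , p , _) (_ , _ , i , p′ , _) →
              All.lookup (proj₁ (Interleaving-All i y∉)) (subst (y ∈_) (inj p p′) (here refl)) refl })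
    (hc-⋆ ys (λ v → P (y ∷ v)) Q u (λ p p′ → ∷-injectiveʳ (inj p p′)) (hP ∘ consˡ) (hQ ∘ consˡ))
    (hc-⋆ ys P (λ v → Q (y ∷ v)) u inj (hP ∘ consʳ) (hQ ∘ consʳ)))

++-∷-injective : {x : X} (v v₁ : List X) {v′ v₁′ : List X} → x ∉ v → x ∉ v₁ →
  v ++ x ∷ v′ ≡ v₁ ++ x ∷ v₁′ → v ≡ v₁ × v′ ≡ v₁′
++-∷-injective [] [] _ _ eq = refl , ∷-injectiveʳ eq
++-∷-injective [] (y ∷ v₁) _ x∉ eq = ⊥-elim (x∉ (here (proj₁ (∷-injective eq))))
++-∷-injective (y ∷ v) [] x∉ _ eq = ⊥-elim (x∉ (here (sym (proj₁ (∷-injective eq)))))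
++-∷-injective (y ∷ v) (z ∷ v₁) x∉ x∉₁ eq with refl , eq′ ← ∷-injective eq =
  let p , q = ++-∷-injective v v₁ (x∉ ∘ there) (x∉₁ ∘ there) eq′ in cong (y ∷_) p , q

Join : ℕ → (List ℕ × List ℕ → Set) → List ℕ → Set
Join x R w = Σ (List ℕ × List ℕ) λ (v , v′) → w ≡ v ++ x ∷ v′ × R (v , v′)

hc-join : (x : ℕ) {R : List ℕ × List ℕ → Set} {c : ℕ} → (∀ {v v′} → R (v , v′) → All (x <_) v) →
  HC R c → HC (Join x R) c
hc-join x x<v = hc-image (λ (v , v′) → v ++ x ∷ v′) (λ {(v , v′)} {(v₁ , v₁′)} r r₁ eq →
  let p , q = ++-∷-injective v v₁ (∉-> (x<v r)) (∉-> (x<v r₁)) eq in cong₂ _,_ p q)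
  where
  ∉-> : ∀ {v} → All (x <_) v → x ∉ v
  ∉-> x<v x∈v = <-irrefl refl (All.lookup x<v x∈v)

-- Words on a set of letters, given as a strictly increasing list

Sorted : List ℕ → Set
Sorted = AllPairs _<_

Sorted-unique : ∀ {xs} → Sorted xs → Unique xs
Sorted-unique = AllPairs.map <⇒≢

Sorted-↭ : ∀ {u u′} → Sorted u → Sorted u′ → u ↭ u′ → u ≡ u′
Sorted-↭ {[]} _ _ p = sym (↭-empty-inv (↭-sym p))
Sorted-↭ {x ∷ u} {[]} _ _ p with () ← ↭-empty-inv p
Sorted-↭ {x ∷ u} {y ∷ u′} (x< ∷ s) (y< ∷ s′) p with ∈-resp-↭ p (here refl) | ∈-resp-↭ (↭-sym p) (here refl)
... | here refl | _ = cong (x ∷_) (Sorted-↭ s s′ (drop-∷ p))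
... | there _ | here refl = cong (x ∷_) (Sorted-↭ s s′ (drop-∷ p))
... | there x∈ | there y∈ = ⊥-elim (<-asym (All.lookup x< y∈) (All.lookup y< x∈))

Sorted-∷ʳ : ∀ {xs t} → Sorted (xs ∷ʳ t) → Sorted xs × All (_< t) xs
Sorted-∷ʳ {[]} _ = [] , []
Sorted-∷ʳ {x ∷ xs} (x< ∷ s) with Sorted-∷ʳ s | Allₚ.++⁻ʳ xs x<
... | s′ , xs<t | x<t ∷ [] = (Allₚ.++⁻ˡ xs x< ∷ s′) , (x<t ∷ xs<t)

Interleaving-Sorted : ∀ {u u′ ys} → Interleaving u u′ ys → Sorted ys → Sorted u × Sorted u′
Interleaving-Sorted [] [] = [] , []
Interleaving-Sorted (consˡ i) (y< ∷ s) =
  let s₁ , s₂ = Interleaving-Sorted i s in (proj₁ (Interleaving-All i y<) ∷ s₁) , s₂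
Interleaving-Sorted (consʳ i) (y< ∷ s) =
  let s₁ , s₂ = Interleaving-Sorted i s in s₁ , (proj₂ (Interleaving-All i y<) ∷ s₂)

Interleaving-∷ʳʳ : ∀ {u u′ ys : List X} {t} → Interleaving u u′ ys → Interleaving u (u′ ∷ʳ t) (ys ∷ʳ t)
Interleaving-∷ʳʳ [] = consʳ []
Interleaving-∷ʳʳ (consˡ i) = consˡ (Interleaving-∷ʳʳ i)
Interleaving-∷ʳʳ (consʳ i) = consʳ (Interleaving-∷ʳʳ i)

Interleaving-∷ʳˡ : ∀ {u u′ ys : List X} {t} → Interleaving u u′ ys → Interleaving (u ∷ʳ t) u′ (ys ∷ʳ t)
Interleaving-∷ʳˡ [] = consˡ []
Interleaving-∷ʳˡ (consˡ i) = consˡ (Interleaving-∷ʳˡ i)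
Interleaving-∷ʳˡ (consʳ i) = consʳ (Interleaving-∷ʳˡ i)

Interleaving-∷ʳ⁻ : (ys : List X) {u u′ : List X} {t : X} → Interleaving u u′ (ys ∷ʳ t) →
  (∃ λ u₁ → u ≡ u₁ ∷ʳ t × Interleaving u₁ u′ ys) ⊎ (∃ λ u₁ → u′ ≡ u₁ ∷ʳ t × Interleaving u u₁ ys)
Interleaving-∷ʳ⁻ [] (consˡ []) = inj₁ ([] , refl , [])
Interleaving-∷ʳ⁻ [] (consʳ []) = inj₂ ([] , refl , [])
Interleaving-∷ʳ⁻ (y ∷ ys) (consˡ i) with Interleaving-∷ʳ⁻ ys i
... | inj₁ (u₁ , refl , j) = inj₁ (y ∷ u₁ , refl , consˡ j)
... | inj₂ (u₁ , refl , j) = inj₂ (u₁ , refl , consˡ j)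
Interleaving-∷ʳ⁻ (y ∷ ys) (consʳ i) with Interleaving-∷ʳ⁻ ys i
... | inj₁ (u₁ , refl , j) = inj₁ (u₁ , refl , consʳ j)
... | inj₂ (u₁ , refl , j) = inj₂ (y ∷ u₁ , refl , consʳ j)

split-↭ : (cs : List X) {v v′ : List X} → v ++ v′ ↭ cs →
  ∃₂ λ u u′ → Interleaving u u′ cs × v ↭ u × v′ ↭ u′
split-↭ [] {[]} p with refl ← ↭-empty-inv p = [] , [] , [] , ↭-refl , ↭-refl
split-↭ [] {x ∷ v} p with () ← ↭-empty-inv p
split-↭ (c ∷ cs) {v} {v′} p with ∈-++⁻ v (∈-resp-↭ (↭-sym p) (here refl))
... | inj₁ c∈v with a , b , refl ← ∈-∃++ c∈v =
  let u , u′ , i , q , q′ = split-↭ cs {a ++ b} {v′} (subst (_↭ cs) (sym (++-assoc a b v′))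
        (drop-mid a [] (subst (_↭ c ∷ cs) (++-assoc a (c ∷ b) v′) p)))
  in c ∷ u , u′ , consˡ i , ↭-trans (shift c a b) (prep c q) , q′
... | inj₂ c∈v′ with a , b , refl ← ∈-∃++ c∈v′ =
  let u , u′ , i , q , q′ = split-↭ cs {v} {a ++ b} (subst (_↭ cs) (++-assoc v a b)
        (drop-mid (v ++ a) [] (subst (_↭ c ∷ cs) (sym (++-assoc v a (c ∷ b))) p)))
  in u , c ∷ u′ , consʳ i , q , ↭-trans (shift c a b) (prep c q′)

join-↭ : {x : X} {u u′ ys v v′ : List X} → Interleaving u u′ ys → v ↭ u → v′ ↭ u′ → v ++ x ∷ v′ ↭ x ∷ ys
join-↭ {x = x} {v = v} {v′} i p p′ = ↭-trans (shift x v v′) (prep x (↭-trans (++⁺ p p′) (↭-sym (toPermutation i))))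

record On (𝓦 : List ℕ → Set) (u v : List ℕ) : Set where
  constructor on
  field
    sorted  : Sorted u
    letters : v ↭ u
    word    : 𝓦 v

open On

On-functional : ∀ {𝓦 u u′ v} → On 𝓦 u v → On 𝓦 u′ v → u ≡ u′
On-functional o o′ = Sorted-↭ (sorted o) (sorted o′) (↭-trans (↭-sym (letters o)) (letters o′))

On-All : ∀ {𝓦 u v} {P : ℕ → Set} → All P u → On 𝓦 u v → All P v
On-All h o = All-resp-↭ (↭-sym (letters o)) h

On-∈ : ∀ {𝓦 u v y} → y ∈ u → On 𝓦 u v → y ∈ v
On-∈ h o = ∈-resp-↭ (↭-sym (letters o)) h

-- x is the least letter of both words, hence x = x′.
split-at-min : ∀ {x x′ v v′ ys} → All (x <_) ys → All (x′ <_) (v ++ v′) → v ++ x′ ∷ v′ ↭ x ∷ ys →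
  x′ ≡ x × v ++ v′ ↭ ys
split-at-min {x} {x′} {v} {v′} {ys} x< x′< p with ∈-resp-↭ p (∈-++⁺ʳ v (here refl))
... | here refl = refl , drop-mid v [] p
... | there x′∈ with ∈-resp-↭ (↭-sym p) (here refl)
... | x∈ with ∈-resp-↭ (shift x′ v v′) x∈
... | here refl = refl , drop-mid v [] p
... | there x∈′ = ⊥-elim (<-asym (All.lookup x< x′∈) (All.lookup x′< x∈′))

join-All : {P : ℕ → Set} {𝓦 : List ℕ → Set} {u u′ ys v v′ : List ℕ} → Interleaving u u′ ys →
  On 𝓦 u v → On 𝓦 u′ v′ → All P ys → All P (v ++ v′)
join-All i o o′ h = Allₚ.++⁺ (On-All (proj₁ (Interleaving-All i h)) o) (On-All (proj₂ (Interleaving-All i h)) o′)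

-- Cutting at the least letter

-- The defining condition of type I pins the greatest letter `t` to the right part, so only the
-- letters between least and greatest are shared out. For type II the pinned letter is the second
-- least.
SplitI : List ℕ → ℕ → List ℕ × List ℕ → Set
SplitI ys t = Split (On AndreI) (λ u′ → On AndreI (u′ ∷ʳ t)) ys

SplitII : ℕ → List ℕ → List ℕ × List ℕ → Set
SplitII y = Split (On AndreII) (λ u′ → On AndreII (y ∷ u′))

splitI : ∀ {x ys t w} → On AndreI (x ∷ ys ∷ʳ t) w → Join x (SplitI ys t) w
splitI {ys = ys} (on _ p andreI-nil) with () ← ↭-empty-inv (↭-sym p)
splitI {ys = []} (on _ p (andreI-single _)) with () ← ↭-length p
splitI {ys = _ ∷ _} (on _ p (andreI-single _)) with () ← ↭-length p
splitI {x} {ys} {t} (on (x< ∷ s) p (andreI-split {v} {v′} a a′ x′< (y , y∈ , ≤y)))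
  with refl , q ← split-at-min x< x′< p
  with u , u″ , i , r , r′ ← split-↭ (ys ∷ʳ t) q
  with Interleaving-∷ʳ⁻ ys i
... | inj₂ (u′ , refl , j) = _ , refl , u , u′ , j ,
  on (proj₁ (Interleaving-Sorted i s)) r a , on (proj₂ (Interleaving-Sorted i s)) r′ a′
... | inj₁ (u₁ , refl , j) = ⊥-elim (<-irrefl refl (<-≤-trans y<t t≤y))
  where
  y<t : y < t
  y<t = All.lookup (proj₂ (Interleaving-All j (proj₂ (Sorted-∷ʳ s)))) (∈-resp-↭ r′ y∈)
  t≤y : t ≤ y
  t≤y = All.lookup ≤y (∈-resp-↭ (↭-sym q) (∈-++⁺ʳ ys (here refl)))

joinI : ∀ {x ys t w} → Sorted (x ∷ ys ∷ʳ t) → Join x (SplitI ys t) w → On AndreI (x ∷ ys ∷ʳ t) w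
joinI {ys = ys} {t} s@(x< ∷ s′) (_ , refl , _ , u′ , j , o , o′) =
  let i = Interleaving-∷ʳʳ j in
  on s (join-↭ i (letters o) (letters o′)) (andreI-split (word o) (word o′) (join-All i o o′ x<)
    (t , On-∈ (∈-++⁺ʳ u′ (here refl)) o′ ,
      join-All i o o′ (Allₚ.++⁺ (All.map <⇒≤ (proj₂ (Sorted-∷ʳ s′))) (≤-refl ∷ []))))

splitII : ∀ {x y zs w} → On AndreII (x ∷ y ∷ zs) w → Join x (SplitII y zs) w
splitII (on _ p andreII-nil) with () ← ↭-empty-inv (↭-sym p)
splitII (on _ p (andreII-single _)) with () ← ↭-length p
splitII {x} {y} {zs} (on (x< ∷ s@(y< ∷ _)) p (andreII-split {v} {v′} a a′ x′< (z , z∈ , z≤)))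
  with refl , q ← split-at-min x< x′< p
  with split-↭ (y ∷ zs) q
... | u , _ , i@(consʳ j) , r , r′ = _ , refl , u , _ , j ,
  on (proj₁ (Interleaving-Sorted i s)) r a , on (proj₂ (Interleaving-Sorted i s)) r′ a′
... | _ , _ , consˡ j , r , r′ = ⊥-elim (<-irrefl refl (<-≤-trans y<z z≤y))
  where
  y<z : y < z
  y<z = All.lookup (proj₂ (Interleaving-All j y<)) (∈-resp-↭ r′ z∈)
  z≤y : z ≤ y
  z≤y = All.lookup z≤ (∈-resp-↭ (↭-sym q) (here refl))

joinII : ∀ {x y zs w} → Sorted (x ∷ y ∷ zs) → Join x (SplitII y zs) w → On AndreII (x ∷ y ∷ zs) w
joinII {y = y} s@(x< ∷ (y< ∷ _)) (_ , refl , _ , _ , j , o , o′) =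
  let i = consʳ j in
  on s (join-↭ i (letters o) (letters o′)) (andreII-split (word o) (word o′) (join-All i o o′ x<)
    (y , On-∈ (here refl) o′ , join-All i o o′ (≤-refl ∷ All.map <⇒≤ y<)))

-- The statistics of a word v ++ x ∷ v′

-- The default `d` stands for the letter at which the word was cut: it is first when the left part
-- is empty, and next to last when the right part has a single letter.
Fᵈ : ℕ → List ℕ → ℕ
Fᵈ d []      = d
Fᵈ d (x ∷ _) = x

NLᵈ : ℕ → List ℕ → ℕ
NLᵈ d []          = d
NLᵈ d (_ ∷ [])    = d
NLᵈ d (x ∷ y ∷ w) = NL (x ∷ y ∷ w)

F-join : ∀ v {x v′} → F (v ++ x ∷ v′) ≡ Fᵈ x v
F-join []      = refl
F-join (_ ∷ _) = refl

NL-join : ∀ v {x y v′} → NL (v ++ x ∷ y ∷ v′) ≡ NLᵈ x (y ∷ v′)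
NL-join [] {v′ = []}    = refl
NL-join [] {v′ = _ ∷ _} = refl
NL-join (z ∷ v)         = trans (NL-∷ v) (NL-join v)
  where
  NL-∷ : ∀ v {z x y v′} → NL (z ∷ v ++ x ∷ y ∷ v′) ≡ NL (v ++ x ∷ y ∷ v′)
  NL-∷ []          = refl
  NL-∷ (_ ∷ [])    = refl
  NL-∷ (_ ∷ _ ∷ _) = refl

L-join : ∀ v {x y v′} → L (v ++ x ∷ y ∷ v′) ≡ L (y ∷ v′)
L-join []          = refl
L-join (_ ∷ [])    = refl
L-join (_ ∷ z ∷ v) = L-join (z ∷ v)

grn'-at : ∀ t d w → grn' t d (t ∷ w) ≡ d ⊔ headOr0 w
grn'-at t d w rewrite ≡ᵇ-refl t = refl

grn'-skip : ∀ {t y} → y ≢ t → ∀ d w → grn' t d (y ∷ w) ≡ grn' t y w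
grn'-skip y≢t d w rewrite ≡ᵇ-false y≢t = refl

grn'-joinʳ : ∀ {t x v′} d v → t ∉ v → x ≢ t → grn' t d (v ++ x ∷ v′) ≡ grn' t x v′
grn'-joinʳ {v′ = v′} d [] _ x≢t = grn'-skip x≢t d v′
grn'-joinʳ {x = x} {v′} d (y ∷ v) t∉ x≢t =
  trans (grn'-skip (λ { refl → t∉ (here refl) }) d (v ++ x ∷ v′)) (grn'-joinʳ y v (t∉ ∘ there) x≢t)

tail-∈ : {y t : X} {v : List X} → y ≢ t → t ∈ y ∷ v → t ∈ v
tail-∈ y≢t (here refl) = ⊥-elim (y≢t refl)
tail-∈ y≢t (there p)   = p

-- The letter `x` could matter only as right neighbour of a final `t`, and there the left neighbour
-- is at least as large.
grn'-++ : ∀ {t x v′} p v → t ∈ v → x ≤ p → All (x <_) v → grn' t p (v ++ x ∷ v′) ≡ grn' t p v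
grn'-++ {t} {x} {v′} p (y ∷ v) t∈ x≤p (x<y ∷ x<v) with y ≟ t
... | yes refl = trans (grn'-at t p (v ++ x ∷ v′)) (trans (at-head v) (sym (grn'-at t p v)))
  where
  at-head : ∀ v → p ⊔ headOr0 (v ++ x ∷ v′) ≡ p ⊔ headOr0 v
  at-head []      = trans (m≥n⇒m⊔n≡m x≤p) (sym (⊔-identityʳ p))
  at-head (_ ∷ _) = refl
... | no y≢t = trans (grn'-skip y≢t p (v ++ x ∷ v′))
  (trans (grn'-++ y v (tail-∈ y≢t t∈) (<⇒≤ x<y) x<v) (sym (grn'-skip y≢t p v)))

-- Replacing the outer letter `d` by `x` matters only if `t` heads `v`. If `v` is `t` alone, `x` is
-- already its right neighbour and exceeds or equals `d`; otherwise the right neighbour exceeds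
-- both.
grn'-joinˡ : ∀ {t x v′} d v → t ∈ v → d ≤ x → All (x <_) v → grn' t d (v ++ x ∷ v′) ≡ grn' t x v
grn'-joinˡ {t} {x} {v′} d (y ∷ v) t∈ d≤x (x<y ∷ x<v) with y ≟ t
... | yes refl = trans (grn'-at t d (v ++ x ∷ v′)) (trans (at-head v x<v) (sym (grn'-at t x v)))
  where
  at-head : ∀ v → All (x <_) v → d ⊔ headOr0 (v ++ x ∷ v′) ≡ x ⊔ headOr0 v
  at-head []      _         = trans (m≤n⇒m⊔n≡n d≤x) (sym (⊔-identityʳ x))
  at-head (z ∷ _) (x<z ∷ _) = trans (m≤n⇒m⊔n≡n (≤-trans d≤x (<⇒≤ x<z))) (sym (m≤n⇒m⊔n≡n (<⇒≤ x<z)))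
... | no y≢t = trans (grn'-skip y≢t d (v ++ x ∷ v′))
  (trans (grn'-++ y v (tail-∈ y≢t t∈) (<⇒≤ x<y) x<v) (sym (grn'-skip y≢t x v)))

-- Type I

-- The joint count carries the induction: with one predicate constantly true it yields, on shorter
-- lists, the separate counts by `F` and by `NL` that describe the two parts of the cut.
CountI : List ℕ → Set
CountI ys = ∀ {x t} (M K : ℕ → Bool) → Sorted (x ∷ ys ∷ʳ t) →
  HC (λ w → On AndreI (x ∷ ys ∷ʳ t) w × M (F w) ≡ true × K (NL w) ≡ true) ((𝓕 M (M x) ⋆ 𝓟 K (K x)) ys)

module _ (n : ℕ) (ih : ∀ ys → length ys < n → CountI ys) where

  count-F : ∀ u → length u ≤ n → Sorted u → ∀ M d →
    HC (λ v → On AndreI u v × M (Fᵈ d v) ≡ true) (𝓕 M (M d) u)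
  count-F [] _ s M d = hc-single [] (M d)
    (λ { (on _ p _ , q) → case (↭-empty-inv p) q }) (λ q → on s ↭-refl andreI-nil , q)
    where
    case : ∀ {w} → w ≡ [] → M (Fᵈ d w) ≡ true → w ≡ [] × M d ≡ true
    case refl q = refl , q
  count-F (x ∷ u) _ s M d with initLast u
  ... | [] = hc-single [ x ] (M x)
    (λ { (on _ p _ , q) → case (↭-singleton-inv p) q }) (λ q → on s ↭-refl (andreI-single x) , q)
    where
    case : ∀ {w} → w ≡ [ x ] → M (Fᵈ d w) ≡ true → w ≡ [ x ] × M x ≡ true
    case refl q = refl , q
  count-F (x ∷ u) p s M d | ys ∷ʳ′ t = hc-cong
    (λ {w} (o , q , _) → o , trans (cong M (sym (F≡ w o))) q) (λ {w} (o , q) → o , trans (cong M (F≡ w o)) q , refl)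
    (trans (⋆-ext (λ _ → refl) 𝓟-all ys) (sym (𝓕⁺-∷ʳ M (M x) ys t)))
    (ih ys (≤-trans (n≤1+n _) (subst (λ l → suc l ≤ n) (length-∷ʳ ys t) p)) M (const true) s)
    where
    F≡ : ∀ w → On AndreI (x ∷ ys ∷ʳ t) w → F w ≡ Fᵈ d w
    F≡ []      o with () ← ↭-length (letters o)
    F≡ (_ ∷ _) _ = refl

  count-NL : ∀ u t → length u ≤ n → Sorted (u ∷ʳ t) → ∀ K d →
    HC (λ v → On AndreI (u ∷ʳ t) v × K (NLᵈ d v) ≡ true) (𝓟 K (K d) u)
  count-NL [] t _ s K d = hc-single [ t ] (K d)
    (λ { (on _ p _ , q) → case (↭-singleton-inv p) q }) (λ q → on s ↭-refl (andreI-single t) , q)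
    where
    case : ∀ {w} → w ≡ [ t ] → K (NLᵈ d w) ≡ true → w ≡ [ t ] × K d ≡ true
    case refl q = refl , q
  count-NL (x ∷ ys) t p s K d = hc-cong
    (λ {w} (o , _ , q) → o , trans (cong K (sym (NL≡ w o))) q) (λ {w} (o , q) → o , refl , trans (cong K (NL≡ w o)) q)
    (trans (⋆-ext 𝓕-all (λ _ → refl) ys) (sym (𝓟-∷ K (K d) x ys)))
    (ih ys p (const true) K s)
    where
    NL≡ : ∀ w → On AndreI (x ∷ ys ∷ʳ t) w → NL w ≡ NLᵈ d w
    NL≡ []          o with () ← ↭-length (letters o)
    NL≡ (_ ∷ [])    o with () ← trans (↭-length (letters o)) (cong suc (length-∷ʳ ys t))
    NL≡ (_ ∷ _ ∷ _) _ = refl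

countI : ∀ ys → CountI ys
countI = length-ind CountI step
  where
  step : ∀ ys → (∀ zs → length zs < length ys → CountI zs) → CountI ys
  step ys ih {x} {t} M K s@(x< ∷ s′) = hc-cong join split refl
    (hc-join x (λ { (_ , _ , i , (o , _) , _) → On-All (proj₁ (Interleaving-All i (Allₚ.++⁻ˡ ys x<))) o })
      (hc-⋆ ys (λ u v → On AndreI u v × M (Fᵈ x v) ≡ true) (λ u′ v′ → On AndreI (u′ ∷ʳ t) v′ × K (NLᵈ x v′) ≡ true)
        (Sorted-unique (proj₁ (Sorted-∷ʳ s′)))
        (λ (o , _) (o′ , _) → On-functional o o′)
        (λ i → count-F (length ys) ih _ (proj₁ (Interleaving-length i))
                 (proj₁ (Interleaving-Sorted i (proj₁ (Sorted-∷ʳ s′)))) M x)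
        (λ i → count-NL (length ys) ih _ t (proj₂ (Interleaving-length i))
                 (proj₂ (Interleaving-Sorted (Interleaving-∷ʳʳ i) s′)) K x)))
    where
    R : List ℕ × List ℕ → Set
    R = Split (λ u v → On AndreI u v × M (Fᵈ x v) ≡ true) (λ u′ v′ → On AndreI (u′ ∷ʳ t) v′ × K (NLᵈ x v′) ≡ true) ys

    NL-eq : ∀ {u′} v v′ → On AndreI (u′ ∷ʳ t) v′ → NL (v ++ x ∷ v′) ≡ NLᵈ x v′
    NL-eq {u′} v []      o with () ← On-∈ (∈-++⁺ʳ u′ (here refl)) o
    NL-eq      v (_ ∷ _) o = NL-join v

    join : ∀ {w} → Join x R w → On AndreI (x ∷ ys ∷ʳ t) w × M (F w) ≡ true × K (NL w) ≡ true
    join ((v , v′) , refl , (u , u′ , i , (o , p) , (o′ , q))) =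
      joinI s ((v , v′) , refl , (u , u′ , i , o , o′)) ,
      trans (cong M (F-join v)) p , trans (cong K (NL-eq v v′ o′)) q

    split : ∀ {w} → On AndreI (x ∷ ys ∷ʳ t) w × M (F w) ≡ true × K (NL w) ≡ true → Join x R w
    split (ow , p , q) with splitI ow
    ... | (v , v′) , refl , (u , u′ , i , o , o′) = (v , v′) , refl ,
      (u , u′ , i , (o , trans (cong M (sym (F-join v))) p) , (o′ , trans (cong K (sym (NL-eq v v′ o′))) q))

-- Type II

CountL : List ℕ → Set
CountL u = ∀ {y} (M : ℕ → Bool) → Sorted (y ∷ u) → HC (λ v → On AndreII (y ∷ u) v × M (L v) ≡ true) (𝓟 M (M y) u)

count-II′ : ∀ n → (∀ u → length u < n → CountL u) → ∀ u → length u ≤ n → Sorted u → HC (On AndreII u) (𝓔 u)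
count-II′ n ih [] _ s = hc-single [] true (λ { (on _ p _) → ↭-empty-inv p , refl }) (λ _ → on s ↭-refl andreII-nil)
count-II′ n ih (y ∷ u) p s = hc-cong proj₁ (_, refl) (𝓟-all u) (ih u p (const true) s)

L-eq : ∀ {x z u′} v v′ → On AndreII (z ∷ u′) v′ → L (v ++ x ∷ v′) ≡ L v′
L-eq v []      o with () ← On-∈ (here refl) o
L-eq v (_ ∷ _) o = L-join v

count-L : ∀ u → CountL u
count-L = length-ind CountL step
  where
  step : ∀ u → (∀ v → length v < length u → CountL v) → CountL u
  step [] ih {y} M s = hc-single [ y ] (M y)
    (λ { (on _ p _ , q) → case (↭-singleton-inv p) q }) (λ q → on s ↭-refl (andreII-single y) , q)
    where
    case : ∀ {w} → w ≡ [ y ] → M (L w) ≡ true → w ≡ [ y ] × M y ≡ true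
    case refl q = refl , q
  step (z ∷ zs) ih {y} M s@((_ ∷ y<) ∷ s′@(_ ∷ s″)) = hc-cong join split (sym (𝓟-∷ M (M y) z zs))
    (hc-join y (λ { (_ , _ , i , o , _) → On-All (proj₁ (Interleaving-All i y<)) o })
      (hc-⋆ zs (On AndreII) (λ u′ v′ → On AndreII (z ∷ u′) v′ × M (L v′) ≡ true)
        (Sorted-unique s″) On-functional
        (λ i → count-II′ (length zs) (λ u p → ih u (m≤n⇒m≤1+n p)) _ (proj₁ (Interleaving-length i))
                 (proj₁ (Interleaving-Sorted i s″)))
        (λ i → ih _ (s≤s (proj₂ (Interleaving-length i))) M (proj₂ (Interleaving-Sorted (consʳ i) s′)))))
    where
    R : List ℕ × List ℕ → Set
    R = Split (On AndreII) (λ u′ v′ → On AndreII (z ∷ u′) v′ × M (L v′) ≡ true) zs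

    join : ∀ {w} → Join y R w → On AndreII (y ∷ z ∷ zs) w × M (L w) ≡ true
    join ((v , v′) , refl , (u , u′ , i , o , (o′ , q))) =
      joinII s ((v , v′) , refl , (u , u′ , i , o , o′)) , trans (cong M (L-eq v v′ o′)) q

    split : ∀ {w} → On AndreII (y ∷ z ∷ zs) w × M (L w) ≡ true → Join y R w
    split (ow , q) with splitII ow
    ... | (v , v′) , refl , (u , u′ , i , o , o′) =
      (v , v′) , refl , (u , u′ , i , o , (o′ , trans (cong M (sym (L-eq v v′ o′))) q))

count-II : ∀ u → Sorted u → HC (On AndreII u) (𝓔 u)
count-II u = count-II′ (length u) (λ v _ → count-L v) u ≤-refl

-- The letter `d` before the word does not occur in the count: there are at least two letters, so
-- `t` has a neighbour inside the word, and that neighbour is at least `x` and hence at least `d`.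
CountII : List ℕ → Set
CountII ys = ∀ {x t d} (M K : ℕ → Bool) → d ≤ x → Sorted (x ∷ ys ∷ʳ t) →
  HC (λ w → On AndreII (x ∷ ys ∷ʳ t) w × M (L w) ≡ true × K (grn' t d w) ≡ true)
     ((𝓛 M (M t) ⋆ 𝓟 K (K x)) ys)

count-grn : ∀ n → (∀ ys → length ys < n → CountII ys) → ∀ u t d → length u ≤ n → Sorted (u ∷ʳ t) →
  All (d ≤_) u → ∀ K → HC (λ v → On AndreII (u ∷ʳ t) v × K (grn' t d v) ≡ true) (𝓟 K (K d) u)
count-grn n ih [] t d _ s _ K = hc-single [ t ] (K d)
  (λ { (on _ p _ , q) → case (↭-singleton-inv p) q })
  (λ q → on s ↭-refl (andreII-single t) , trans (cong K alone) q)
  where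
  alone : grn' t d [ t ] ≡ d
  alone = trans (grn'-at t d []) (⊔-identityʳ d)
  case : ∀ {w} → w ≡ [ t ] → K (grn' t d w) ≡ true → w ≡ [ t ] × K d ≡ true
  case refl q = refl , trans (cong K (sym alone)) q
count-grn n ih (x ∷ ys) t d p s (d≤x ∷ _) K = hc-cong
  (λ (o , _ , q) → o , q) (λ (o , q) → o , refl , q)
  (trans (⋆-ext 𝓛-all (λ _ → refl) ys) (sym (𝓟-∷ K (K d) x ys)))
  (ih ys p (const true) K d≤x s)

∧-true : ∀ {a b} → a ∧ b ≡ true → a ≡ true × b ≡ true
∧-true {true} {true} _ = refl , refl

⟦⟧-∧ : ∀ a b → ⟦ a ∧ b ⟧ ≡ ⟦ a ⟧ * ⟦ b ⟧
⟦⟧-∧ false b = refl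
⟦⟧-∧ true  b = sym (*-identityˡ ⟦ b ⟧)

countII : ∀ ys → CountII ys
countII = length-ind CountII step
  where
  step : ∀ ys → (∀ zs → length zs < length ys → CountII zs) → CountII ys
  -- With nothing in between, the second least letter is `t` itself, and the only word is `x`
  -- followed by `t`.
  step [] ih {x} {t} {d} M K d≤x s@((x<t ∷ []) ∷ _) = hc-cong id id (⟦⟧-∧ (M t) (K x))
    (hc-single (x ∷ t ∷ []) (M t ∧ K x) only
      (λ q → joinII s (([] , [ t ]) , refl ,
               ([] , [] , [] , on [] ↭-refl andreII-nil , on ([] ∷ []) ↭-refl (andreII-single t))) ,
             proj₁ (∧-true q) , trans (cong K grn-x) (proj₂ (∧-true {M t} q))))
    where
    grn-x : grn' t d (x ∷ t ∷ []) ≡ x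
    grn-x = trans (grn'-skip (<⇒≢ x<t) d [ t ]) (trans (grn'-at t x []) (⊔-identityʳ x))
    only : ∀ {w} → On AndreII (x ∷ t ∷ []) w × M (L w) ≡ true × K (grn' t d w) ≡ true →
      w ≡ x ∷ t ∷ [] × M t ∧ K x ≡ true
    only (ow , p , q) with splitII ow
    ... | _ , refl , (_ , _ , [] , on _ r _ , on _ r′ _)
      with refl ← ↭-empty-inv r | refl ← ↭-singleton-inv r′ = refl , cong₂ _∧_ p (trans (cong K (sym grn-x)) q)
  step (y ∷ zs) ih {x} {t} {d} M K d≤x s@((x<y ∷ x<) ∷ s′@(y< ∷ s″)) = hc-cong join split count
    (hc-join x
      [ (λ { (_ , _ , i , (o , _) , _) → On-All (proj₁ (Interleaving-All (Interleaving-∷ʳˡ i) x<)) o }) ,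
        (λ { (_ , _ , i , o , _) → On-All (proj₁ (Interleaving-All i x<zs)) o }) ]′
      -- The second least letter `y` is forced right, but `t` may go to either side. On the left it
      -- leaves `grn` to the left part and `L` to the right one; on the right both statistics stay
      -- there.
      (hc-⊎ disjoint
        (hc-⋆ zs _ _ (Sorted-unique zs-sorted) (λ (o , _) (o′ , _) → ∷ʳ-injectiveˡ _ _ (On-functional o o′))
          (λ i → count-grn (length zs) (λ v p → ih v (m≤n⇒m≤1+n p)) _ t x (proj₁ (Interleaving-length i))
                   (proj₁ (Interleaving-Sorted (Interleaving-∷ʳˡ i) s″))
                   (All.map <⇒≤ (proj₁ (Interleaving-All i x<zs))) K)
          (λ i → count-L _ M (proj₂ (Interleaving-Sorted (consʳ i) (y<zs ∷ zs-sorted)))))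
        (hc-⋆ zs _ _ (Sorted-unique zs-sorted) On-functional
          (λ i → count-II _ (proj₁ (Interleaving-Sorted i zs-sorted)))
          (λ i → ih _ (s≤s (proj₂ (Interleaving-length i))) M K (<⇒≤ x<y)
                   (proj₂ (Interleaving-Sorted (consʳ (Interleaving-∷ʳʳ i)) s′))))))
    where
    zs-sorted : Sorted zs
    zs-sorted = proj₁ (Sorted-∷ʳ s″)
    zs<t : All (_< t) zs
    zs<t = proj₂ (Sorted-∷ʳ s″)
    x<zs : All (x <_) zs
    x<zs = Allₚ.++⁻ˡ zs x<
    y<zs : All (y <_) zs
    y<zs = Allₚ.++⁻ˡ zs y<
    x<t : x < t
    x<t = All.lookup x< (∈-++⁺ʳ zs (here refl))

    Rˡ Rʳ : List ℕ × List ℕ → Set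
    Rˡ = Split (λ u v → On AndreII (u ∷ʳ t) v × K (grn' t x v) ≡ true)
               (λ u′ v′ → On AndreII (y ∷ u′) v′ × M (L v′) ≡ true) zs
    Rʳ = Split (On AndreII)
               (λ u′ v′ → On AndreII (y ∷ u′ ∷ʳ t) v′ × M (L v′) ≡ true × K (grn' t x v′) ≡ true) zs

    t∉ : ∀ {u u′ v} → Interleaving u u′ zs → On AndreII u v → t ∉ v
    t∉ i o t∈v = <-irrefl refl (All.lookup (On-All (proj₁ (Interleaving-All i zs<t)) o) t∈v)

    t∈ : ∀ {u v} → On AndreII (u ∷ʳ t) v → t ∈ v
    t∈ {u} = On-∈ (∈-++⁺ʳ u (here refl))

    disjoint : ∀ {p} → Rˡ p → ¬ Rʳ p
    disjoint (_ , _ , _ , (o , _) , _) (_ , _ , i , o′ , _) = t∉ i o′ (t∈ o)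

    grnˡ : ∀ {u u′ v v′} → Interleaving u u′ zs → On AndreII (u ∷ʳ t) v → grn' t d (v ++ x ∷ v′) ≡ grn' t x v
    grnˡ {v = v} i o = grn'-joinˡ d v (t∈ o) d≤x (On-All (proj₁ (Interleaving-All (Interleaving-∷ʳˡ i) x<)) o)

    grnʳ : ∀ {u u′ v v′} → Interleaving u u′ zs → On AndreII u v → grn' t d (v ++ x ∷ v′) ≡ grn' t x v′
    grnʳ {v = v} i o = grn'-joinʳ d v (t∉ i o) (<⇒≢ x<t)

    join : ∀ {w} → Join x (λ p → Rˡ p ⊎ Rʳ p) w →
      On AndreII (x ∷ y ∷ zs ∷ʳ t) w × M (L w) ≡ true × K (grn' t d w) ≡ true
    join ((v , v′) , refl , inj₁ (u , u′ , i , (o , q) , (o′ , p))) =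
      joinII s ((v , v′) , refl , (u ∷ʳ t , u′ , Interleaving-∷ʳˡ i , o , o′)) ,
      trans (cong M (L-eq v v′ o′)) p , trans (cong K (grnˡ i o)) q
    join ((v , v′) , refl , inj₂ (u , u′ , i , o , (o′ , p , q))) =
      joinII s ((v , v′) , refl , (u , u′ ∷ʳ t , Interleaving-∷ʳʳ i , o , o′)) ,
      trans (cong M (L-eq v v′ o′)) p , trans (cong K (grnʳ i o)) q

    split : ∀ {w} → On AndreII (x ∷ y ∷ zs ∷ʳ t) w × M (L w) ≡ true × K (grn' t d w) ≡ true →
      Join x (λ p → Rˡ p ⊎ Rʳ p) w
    split (ow , p , q) with splitII ow
    ... | (v , v′) , refl , (u , u′ , i , o , o′) with Interleaving-∷ʳ⁻ zs i
    ... | inj₁ (u₁ , refl , j) = (v , v′) , refl , inj₁ (u₁ , u′ , j ,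
      (o , trans (cong K (sym (grnˡ j o))) q) , (o′ , trans (cong M (sym (L-eq v v′ o′))) p))
    ... | inj₂ (u₁ , refl , j) = (v , v′) , refl , inj₂ (u , u₁ , j ,
      o , (o′ , trans (cong M (sym (L-eq v v′ o′))) p , trans (cong K (sym (grnʳ j o))) q))

    -- The Leibniz rule read backwards. The case with `t` on the left is `𝓛` differentiated at `y`,
    -- the case with `t` on the right is `𝓟 K (K x)` differentiated at `y`.
    count : (𝓟 K (K x) ⋆ 𝓟 M (M y)) zs + (𝓔 ⋆ (𝓛 M (M t) ⋆ 𝓟 K (K y))) zs ≡ (𝓛 M (M t) ⋆ 𝓟 K (K x)) (y ∷ zs)
    count = cong₂ _+_ (⋆-comm (𝓟 K (K x)) (𝓟 M (M y)) zs)
      (trans (⋆-left-comm 𝓔 (𝓛 M (M t)) (𝓟 K (K y)) zs)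
             (⋆-ext {φ = 𝓛 M (M t)} (λ _ → refl) (λ v → sym (𝓟-∷ K (K x) y v)) zs))

-- Words on oneTo n

≡ᵇ⇒≡′ : ∀ {x y} → (x ≡ᵇ y) ≡ true → x ≡ y
≡ᵇ⇒≡′ {x} {y} p = ≡ᵇ⇒≡ x y (subst T (sym p) tt)

≡⇒≡ᵇ′ : ∀ {x y} → x ≡ y → (x ≡ᵇ y) ≡ true
≡⇒≡ᵇ′ {x} refl = ≡ᵇ-refl x

inner : ℕ → List ℕ
inner N = applyUpTo (2 +_) N

oneTo-ends : ∀ N → oneTo (2 + N) ≡ 1 ∷ inner N ∷ʳ (2 + N)
oneTo-ends N = trans (map-applyUpTo id suc (2 + N)) (cong (1 ∷_) (sym (applyUpTo-∷ʳ (2 +_) N)))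

oneTo-sorted : ∀ n → Sorted (oneTo n)
oneTo-sorted n = subst Sorted (sym (map-applyUpTo id suc n)) (AllPairsₚ.applyUpTo⁺₁ suc n (λ i<j _ → s≤s i<j))

length-oneTo : ∀ n → length (oneTo n) ≡ n
length-oneTo n = trans (length-map suc (upTo n)) (length-upTo n)

∈-oneTo⁻ : ∀ {n j} → j ∈ oneTo n → ∃ λ i → j ≡ suc i × i < n
∈-oneTo⁻ p with i , i∈ , refl ← ∈-map⁻ suc p = i , refl , ∈-upTo⁻ i∈

module _ (N : ℕ) where

  private
    n : ℕ
    n = 2 + N

    ends-sorted : Sorted (1 ∷ inner N ∷ʳ n)
    ends-sorted = subst Sorted (oneTo-ends N) (oneTo-sorted n)

    On-ends : ∀ {𝓦 w} → w ↭ oneTo n → 𝓦 w → On 𝓦 (1 ∷ inner N ∷ʳ n) w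
    On-ends {w = w} p a = on ends-sorted (subst (w ↭_) (oneTo-ends N) p) a

    On-ends⁻ : ∀ {𝓦 w} → On 𝓦 (1 ∷ inner N ∷ʳ n) w → w ↭ oneTo n
    On-ends⁻ {w = w} o = subst (w ↭_) (sym (oneTo-ends N)) (On.letters o)

    length-word : ∀ {w} → w ↭ oneTo n → length w ≡ n
    length-word p = trans (↭-length p) (length-oneTo n)

  module _ (i κ : ℕ) where

    private
      Mᵢ Kκ : ℕ → Bool
      Mᵢ = _≡ᵇ suc i
      Kκ = _≡ᵇ suc κ

      mark : ℕ → Bool × Bool
      mark x = Mᵢ x , Kκ x

      marked-inner : applyUpTo (λ x → (suc x ≡ᵇ i) , (suc x ≡ᵇ κ)) N ≡ map mark (inner N)
      marked-inner = sym (map-applyUpTo (2 +_) mark N)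

    α-count : HasCount (λ w → AndI n w × (F w , NL w) ≡ (suc i , suc κ)) (α (suc N) i κ)
    α-count = hc-cong
      (λ (o , p , q) → (On-ends⁻ o , On.word o) , cong₂ _,_ (≡ᵇ⇒≡′ p) (≡ᵇ⇒≡′ q))
      (λ ((p , a) , eq) → On-ends p a , ≡⇒≡ᵇ′ (cong proj₁ eq) , ≡⇒≡ᵇ′ (cong proj₂ eq))
      (sym (trans (cong (𝓕 proj₁ (0 ≡ᵇ i) ⋆ 𝓟 proj₂ (0 ≡ᵇ κ)) marked-inner)
        (trans (⋆-map mark (𝓕 proj₁ (0 ≡ᵇ i)) (𝓟 proj₂ (0 ≡ᵇ κ)) (inner N))
          (⋆-ext (𝓕-map mark proj₁ (0 ≡ᵇ i)) (λ v → 𝓟-map mark proj₂ v (0 ≡ᵇ κ)) (inner N)))))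
      (countI (inner N) Mᵢ Kκ ends-sorted)

    β-count : HasCount (λ w → AndII n w × (L w , grn w) ≡ (suc i , suc κ)) (β (suc N) i κ)
    β-count = hc-cong
      (λ {w} (o , p , q) → (On-ends⁻ o , On.word o) ,
        cong₂ _,_ (≡ᵇ⇒≡′ p) (trans (cong (λ l → grn' l 0 w) (length-word (On-ends⁻ o))) (≡ᵇ⇒≡′ q)))
      (λ {w} ((p , a) , eq) → On-ends p a , ≡⇒≡ᵇ′ (cong proj₁ eq) ,
        ≡⇒≡ᵇ′ (trans (cong (λ l → grn' l 0 w) (sym (length-word p))) (cong proj₂ eq)))
      (sym (trans (cong (𝓛 proj₁ (suc N ≡ᵇ i) ⋆ 𝓟 proj₂ (0 ≡ᵇ κ)) marked-inner)
        (trans (⋆-map mark (𝓛 proj₁ (suc N ≡ᵇ i)) (𝓟 proj₂ (0 ≡ᵇ κ)) (inner N))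
          (⋆-ext (𝓛-map mark proj₁ (suc N ≡ᵇ i)) (λ v → 𝓟-map mark proj₂ v (0 ≡ᵇ κ)) (inner N)))))
      (countII (inner N) Mᵢ Kκ z≤n ends-sorted)

  -- Column sums

  module _ (κ : ℕ) where

    private
      K : ℕ → Bool
      K = _≡ᵇ suc κ

      π-word : 𝓟 K false (1 ∷ inner N) ≡ π (suc N) κ
      π-word = trans (sym (𝓟-map K id (1 ∷ inner N) false)) (cong (𝓟 id false) (map-applyUpTo suc K (suc N)))

    NL-count : HasCount (λ w → AndI n w × NL w ≡ suc κ) (π (suc N) κ)
    NL-count = hc-cong
      (λ {w} (o , q) → (On-ends⁻ o , On.word o) , trans (sym (NLᵈ-0 w)) (≡ᵇ⇒≡′ q))
      (λ {w} ((p , a) , q) → On-ends p a , ≡⇒≡ᵇ′ (trans (NLᵈ-0 w) q))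
      π-word
      (count-NL (suc (length (inner N))) (λ ys _ → countI ys) (1 ∷ inner N) n ≤-refl ends-sorted K 0)
      where
      NLᵈ-0 : ∀ w → NLᵈ 0 w ≡ NL w
      NLᵈ-0 []          = refl
      NLᵈ-0 (_ ∷ [])    = refl
      NLᵈ-0 (_ ∷ _ ∷ _) = refl

    grn-count : HasCount (λ w → AndII n w × grn w ≡ suc κ) (π (suc N) κ)
    grn-count = hc-cong
      (λ {w} (o , q) → (On-ends⁻ o , On.word o) , trans (cong (λ l → grn' l 0 w) (length-word (On-ends⁻ o))) (≡ᵇ⇒≡′ q))
      (λ {w} ((p , a) , q) → On-ends p a , ≡⇒≡ᵇ′ (trans (cong (λ l → grn' l 0 w) (sym (length-word p))) q))
      π-word
      (count-grn (suc (length (inner N))) (λ ys _ → countII ys) (1 ∷ inner N) n 0 ≤-refl ends-sorted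
        (All.tabulate (λ _ → z≤n)) K)

    F-∈ : ∀ {w} → w ↭ oneTo n → F w ∈ oneTo n
    F-∈ {[]}    p with () ← ↭-length p
    F-∈ {x ∷ w} p = ∈-resp-↭ p (here refl)

    L-∈ : ∀ {w} → w ↭ oneTo n → L w ∈ oneTo n
    L-∈ {[]}    p with () ← ↭-length p
    L-∈ {x ∷ w} p = ∈-resp-↭ p (last x w)
      where
      last : ∀ x w → L (x ∷ w) ∈ x ∷ w
      last x []      = here refl
      last x (y ∷ w) = there (last y w)

    -- One set of words is counted twice: sorted by first letter it gives the column sum, directly
    -- it gives `π`.
    colSum-α : (A : Mat) → (∀ i → i ≤ suc N → A n (suc i) (suc κ) ≡ α (suc N) i κ) →
      colSum A n (suc κ) ≡ π (suc N) κ
    colSum-α A agree = hc-unique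
      (hc-cong {Q = λ w → AndI n w × NL w ≡ suc κ} proj₁ (λ {w} q → q , F-∈ (proj₁ (proj₁ q))) refl
        (hc-sum F (λ m → A n m (suc κ)) (oneTo n) (Sorted-unique (oneTo-sorted n)) column))
      NL-count
      where
      column : ∀ {j} → j ∈ oneTo n → HC (λ w → (AndI n w × NL w ≡ suc κ) × F w ≡ j) (A n j (suc κ))
      column j∈ with i , refl , s≤s i≤ ← ∈-oneTo⁻ j∈ = hc-cong
        (λ (a , eq) → (a , cong proj₂ eq) , cong proj₁ eq) (λ ((a , q) , p) → a , cong₂ _,_ p q)
        (sym (agree i i≤)) (α-count i κ)

    colSum-β : (B : Mat) → (∀ i → i ≤ suc N → B n (suc i) (suc κ) ≡ β (suc N) i κ) →
      colSum B n (suc κ) ≡ π (suc N) κ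
    colSum-β B agree = hc-unique
      (hc-cong {Q = λ w → AndII n w × grn w ≡ suc κ} proj₁ (λ {w} q → q , L-∈ (proj₁ (proj₁ q))) refl
        (hc-sum L (λ m → B n m (suc κ)) (oneTo n) (Sorted-unique (oneTo-sorted n)) column))
      grn-count
      where
      column : ∀ {j} → j ∈ oneTo n → HC (λ w → (AndII n w × grn w ≡ suc κ) × L w ≡ j) (B n j (suc κ))
      column j∈ with i , refl , s≤s i≤ ← ∈-oneTo⁻ j∈ = hc-cong
        (λ (a , eq) → (a , cong proj₂ eq) , cong proj₁ eq) (λ ((a , q) , p) → a , cong₂ _,_ p q)
        (sym (agree i i≤)) (β-count i κ)

-- Uniqueness of the twin Seidel matrix sequence

α-above : ∀ N i κ → i < κ → i ≤ N → α (2 + N) i (suc κ) ≡ α (2 + N) (suc i) (suc κ) + β (suc N) i κ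
α-above N i κ i<κ i≤N with l , refl ← m≤n⇒∃[o]m+o≡n i≤N = proj₁ (exchange i l (suc κ) κ (neighbours-above i l κ i<κ))

β-above : ∀ N i κ → i < κ → i ≤ N → β (2 + N) (suc i) (suc κ) ≡ β (2 + N) i (suc κ) + α (suc N) i κ
β-above N i κ i<κ i≤N with l , refl ← m≤n⇒∃[o]m+o≡n i≤N = proj₂ (exchange i l (suc κ) κ (neighbours-above i l κ i<κ))

β-below : ∀ N i κ → κ < i → i ≤ N → β (2 + N) (suc i) κ ≡ β (2 + N) i κ + α (suc N) i κ
β-below N i κ κ<i i≤N with l , refl ← m≤n⇒∃[o]m+o≡n i≤N = proj₂ (exchange i l κ κ (neighbours-below i l κ κ<i))

-- The range of `i` is one row longer than in `β-below`, as in `ts5c` against `ts4c`. The additional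
-- row compares with the last row, which is zero.
α-below : ∀ N i κ → κ < i → i ≤ suc N → α (2 + N) i κ ≡ α (2 + N) (suc i) κ + β (suc N) i κ
α-below N i κ κ<i i≤1+N with m≤n⇒m<n∨m≡n i≤1+N
... | inj₂ refl = trans (α-row-penultimate N κ κ<i) (cong (_+ β (suc N) (suc N) κ) (sym (α-row-last (suc N) κ)))
... | inj₁ (s≤s i≤N) with l , refl ← m≤n⇒∃[o]m+o≡n i≤N = proj₁ (exchange i l κ κ (neighbours-below i l κ κ<i))

module _ {A B : Mat} (twin : TwinSeidel A B) where

  open TwinSeidel twin

  Agree : ℕ → Set
  Agree N = ∀ i κ → i ≤ N → κ ≤ N → A (suc N) (suc i) (suc κ) ≡ α N i κ × B (suc N) (suc i) (suc κ) ≡ β N i κ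

  agree-base : Agree 1
  agree-base 0 0 _ _ = ts3a11 , ts3b11
  agree-base 0 1 _ _ = ts3a12 , ts3b12
  agree-base 1 0 _ _ = ts3a21 , ts3b21
  agree-base 1 1 _ _ = ts3a22 , ts3b22
  agree-base (suc (suc _)) _ (s≤s ()) _
  agree-base 0 (suc (suc _)) _ (s≤s ())
  agree-base 1 (suc (suc _)) _ (s≤s ())

  module _ (N : ℕ) (ih : Agree (suc N)) where

    private
      n : ℕ
      n = 3 + N

      3≤n : 3 ≤ n
      3≤n = s≤s (s≤s (s≤s z≤n))

      1≤suc : ∀ {i} → 1 ≤ suc i
      1≤suc = s≤s z≤n

    colSum-A : ∀ κ → κ ≤ suc N → colSum A (2 + N) (suc κ) ≡ π (suc N) κ
    colSum-A κ κ≤ = colSum-α N κ A (λ i i≤ → proj₁ (ih i κ i≤ κ≤))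

    colSum-B : ∀ κ → κ ≤ suc N → colSum B (2 + N) (suc κ) ≡ π (suc N) κ
    colSum-B κ κ≤ = colSum-β N κ B (λ i i≤ → proj₂ (ih i κ i≤ κ≤))

    above-A : ∀ i κ → i ≤ κ → κ ≤ N → A n (suc i) (2 + κ) ≡ α (2 + N) i (suc κ)
    above-A zero κ _ κ≤N = begin
      A n 1 (2 + κ)                ≡⟨ ts5a 3≤n (s≤s (s≤s z≤n)) (s≤s (s≤s κ≤N)) ⟩
      colSum B (2 + N) (suc κ)     ≡⟨ colSum-B κ (m≤n⇒m≤1+n κ≤N) ⟩
      π (suc N) κ                  ≡⟨ α-first (suc N) κ ⟨
      α (2 + N) 0 (suc κ)          ∎
    above-A (suc i) κ i<κ κ≤N = +-cancelʳ-≡ (β (suc N) i κ) _ _ (begin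
      A n (2 + i) (2 + κ) + β (suc N) i κ
        ≡⟨ cong₂ _+_ (cong (λ m → A n (suc m) (2 + κ)) (+-comm 1 i))
             (sym (proj₂ (ih i κ (m≤n⇒m≤1+n i≤N) (m≤n⇒m≤1+n κ≤N)))) ⟩
      A n (suc i + 1) (2 + κ) + B (2 + N) (suc i) (suc κ)
        ≡⟨ ts5b {n} {suc i} {2 + κ} 3≤n (s≤s (m≤n+m 2 i))
             (subst (_≤ 2 + κ) (+-comm 2 (suc i)) (s≤s (s≤s i<κ))) (s≤s (s≤s κ≤N)) ⟩
      A n (suc i) (2 + κ)           ≡⟨ above-A i κ (<⇒≤ i<κ) κ≤N ⟩
      α (2 + N) i (suc κ)           ≡⟨ α-above N i κ i<κ i≤N ⟩
      α (2 + N) (suc i) (suc κ) + β (suc N) i κ ∎)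
      where
      i≤N : i ≤ N
      i≤N = ≤-trans (<⇒≤ i<κ) κ≤N

    -- Below the diagonal the known row is the last one, so the induction climbs, with `d` the
    -- distance to it. Above the diagonal it descends from the first row.
    below-A : ∀ d i κ → i + d ≡ 2 + N → κ < i → A n (suc i) (suc κ) ≡ α (2 + N) i κ
    below-A zero i κ eq κ<i with refl ← trans (sym (+-identityʳ i)) eq =
      trans (ts2c 3≤n 1≤suc (s≤s (<⇒≤ κ<i))) (sym (α-row-last (suc N) κ))
    below-A (suc d) i κ eq κ<i = begin
      A n (suc i) (suc κ)
        ≡⟨ ts5c {n} {suc i} {suc κ} 3≤n (s≤s (m≤n+m 1 κ))
             (subst (_≤ suc i) (cong suc (+-comm 1 κ)) (s≤s κ<i)) (s≤s i≤) ⟨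
      A n (suc i + 1) (suc κ) + B (2 + N) (suc i) (suc κ)
        ≡⟨ cong₂ _+_ (cong (λ m → A n (suc m) (suc κ)) (+-comm i 1)) (proj₂ (ih i κ i≤ (≤-trans (<⇒≤ κ<i) i≤))) ⟩
      A n (2 + i) (suc κ) + β (suc N) i κ
        ≡⟨ cong (_+ β (suc N) i κ) (below-A d (suc i) κ (trans (sym (+-suc i d)) eq) (m≤n⇒m≤1+n κ<i)) ⟩
      α (2 + N) (suc i) κ + β (suc N) i κ
        ≡⟨ α-below N i κ κ<i i≤ ⟨
      α (2 + N) i κ ∎
      where
      i≤ : i ≤ suc N
      i≤ = s≤s⁻¹ (subst (suc i ≤_) eq (subst (suc i ≤_) (sym (+-suc i d)) (s≤s (m≤m+n i d))))

    above-B : ∀ i κ → i ≤ κ → κ ≤ N → B n (suc i) (2 + κ) ≡ β (2 + N) i (suc κ)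
    above-B zero κ _ κ≤N = trans (ts2d 3≤n 1≤suc (m≤n⇒m≤1+n (s≤s (s≤s κ≤N)))) (sym (β-row-first (suc N) (suc κ)))
    above-B (suc i) κ i<κ κ≤N = begin
      B n (2 + i) (2 + κ)           ≡⟨ cong (λ m → B n (suc m) (2 + κ)) (+-comm 1 i) ⟩
      B n (suc i + 1) (2 + κ)
        ≡⟨ ts4d {n} {suc i} {2 + κ} 3≤n (s≤s (m≤n+m 2 i))
             (subst (_≤ 2 + κ) (+-comm 2 (suc i)) (s≤s (s≤s i<κ))) (s≤s (s≤s κ≤N)) ⟩
      B n (suc i) (2 + κ) + A (2 + N) (suc i) (suc κ)
        ≡⟨ cong₂ _+_ (above-B i κ (<⇒≤ i<κ) κ≤N) (proj₁ (ih i κ (m≤n⇒m≤1+n i≤N) (m≤n⇒m≤1+n κ≤N))) ⟩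
      β (2 + N) i (suc κ) + α (suc N) i κ
        ≡⟨ β-above N i κ i<κ i≤N ⟨
      β (2 + N) (suc i) (suc κ) ∎
      where
      i≤N : i ≤ N
      i≤N = ≤-trans (<⇒≤ i<κ) κ≤N

    -- The climb starts one row higher than for `A`, in the row given by `ts4b`; the last row has
    -- its own rule.
    below-B : ∀ d i κ → i + d ≡ suc N → κ < i → B n (suc i) (suc κ) ≡ β (2 + N) i κ
    below-B zero i κ eq κ<i with refl ← trans (sym (+-identityʳ i)) eq = begin
      B n (2 + N) (suc κ)           ≡⟨ ts4b 3≤n 1≤suc κ<i ⟩
      colSum A (2 + N) (suc κ)      ≡⟨ colSum-A κ (<⇒≤ κ<i) ⟩
      π (suc N) κ                   ≡⟨ β-row-penultimate N κ κ<i ⟨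
      β (2 + N) (suc N) κ           ∎
    below-B (suc d) i κ eq κ<i = +-cancelʳ-≡ (α (suc N) i κ) _ _ (begin
      B n (suc i) (suc κ) + α (suc N) i κ
        ≡⟨ cong (B n (suc i) (suc κ) +_) (proj₁ (ih i κ (m≤n⇒m≤1+n i≤N) (≤-trans (<⇒≤ κ<i) (m≤n⇒m≤1+n i≤N)))) ⟨
      B n (suc i) (suc κ) + A (2 + N) (suc i) (suc κ)
        ≡⟨ ts4c {n} {suc i} {suc κ} 3≤n (s≤s (m≤n+m 1 κ))
             (subst (_≤ suc i) (cong suc (+-comm 1 κ)) (s≤s κ<i)) (s≤s i≤N) ⟨
      B n (suc i + 1) (suc κ)       ≡⟨ cong (λ m → B n (suc m) (suc κ)) (+-comm i 1) ⟩
      B n (2 + i) (suc κ)           ≡⟨ below-B d (suc i) κ (trans (sym (+-suc i d)) eq) (m≤n⇒m≤1+n κ<i) ⟩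
      β (2 + N) (suc i) κ           ≡⟨ β-below N i κ κ<i i≤N ⟩
      β (2 + N) i κ + α (suc N) i κ ∎)
      where
      i≤N : i ≤ N
      i≤N = s≤s⁻¹ (subst (suc i ≤_) eq (subst (suc i ≤_) (sym (+-suc i d)) (s≤s (m≤m+n i d))))

    last-row-B : ∀ κ → κ < 2 + N → B n n (suc κ) ≡ β (2 + N) (2 + N) κ
    last-row-B zero _ = trans (ts2e 3≤n) (sym (β-last-1 N))
    last-row-B (suc κ) (s≤s κ<1+N) = trans (ts4a 3≤n (s≤s (s≤s z≤n)) (s≤s κ<1+N))
      (trans (colSum-A κ (<⇒≤ κ<1+N)) (sym (β-last (suc N) κ)))

    agree-A : ∀ i κ → i ≤ 2 + N → κ ≤ 2 + N → A n (suc i) (suc κ) ≡ α (2 + N) i κ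
    agree-A i κ i≤ κ≤ with <-cmp i κ
    ... | tri≈ _ refl _ = trans (ts1a (s≤s (s≤s z≤n)) 1≤suc (s≤s i≤) (λ ())) (sym (α-diagonal N i))
    ... | tri> _ _ κ<i with d , eq ← m≤n⇒∃[o]m+o≡n i≤ = below-A d i κ eq κ<i
    ... | tri< i<κ _ _ with m≤n⇒m<n∨m≡n κ≤
    ...   | inj₂ refl = trans (ts2a 3≤n 1≤suc (s≤s i≤)) (sym (α-col-last (suc N) i))
    agree-A i (suc κ) i≤ κ≤ | tri< (s≤s i≤κ) _ _ | inj₁ (s≤s (s≤s κ≤N)) = above-A i κ i≤κ κ≤N

    agree-B : ∀ i κ → i ≤ 2 + N → κ ≤ 2 + N → B n (suc i) (suc κ) ≡ β (2 + N) i κ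
    -- The last column precedes the diagonal because `β-diagonal` excludes the corner, where the
    -- greatest letter would carry the row mark.
    agree-B i κ i≤ κ≤ with m≤n⇒m<n∨m≡n κ≤
    ... | inj₂ refl = trans (ts2b 3≤n 1≤suc (s≤s i≤)) (sym (β-col-last (suc N) i))
    ... | inj₁ κ< with <-cmp i κ
    ...   | tri≈ _ refl _ = trans (ts1b (s≤s (s≤s z≤n)) 1≤suc (s≤s i≤)) (sym (β-diagonal (suc N) i κ<))
    ...   | tri> _ _ κ<i with m≤n⇒m<n∨m≡n i≤
    ...     | inj₂ refl = last-row-B κ κ<
    ...     | inj₁ (s≤s i≤1+N) with d , eq ← m≤n⇒∃[o]m+o≡n i≤1+N = below-B d i κ eq κ<i
    agree-B i (suc κ) i≤ κ≤ | inj₁ (s≤s (s≤s κ≤N)) | tri< (s≤s i≤κ) _ _ = above-B i κ i≤κ κ≤N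

  agree : ∀ N → Agree (suc N)
  agree zero    = agree-base
  agree (suc N) i κ i≤ κ≤ = agree-A N (agree N) i κ i≤ κ≤ , agree-B N (agree N) i κ i≤ κ≤

theorem1p2 : (A B : Mat) → TwinSeidel A B →
    ∀ n m k → 2 ≤ n → 1 ≤ m → m ≤ n → 1 ≤ k → k ≤ n →
    HasCount (λ w → AndI n w × (F w , NL w) ≡ (m , k)) (A n m k)
    × HasCount (λ w → AndII n w × (L w , grn w) ≡ (m , k)) (B n m k)
theorem1p2 A B twin (suc (suc N)) (suc i) (suc κ) _ _ (s≤s i≤) _ (s≤s κ≤) =
  let a , b = agree twin N i κ i≤ κ≤ in
  hc-cong id id (sym a) (α-count N i κ) , hc-cong id id (sym b) (β-count N i κ)
theorem1p2 A B twin 1 m k (s≤s ()) _ _ _ _
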